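{- Let $T$ and $B$ be lattice paths with steps $N=(0,1)$ and $E=(1,0)$ from the origin to $(x,y)\in\mathbb N^2$, with $T$ weakly above $B$, and let $k\ge1$. For any sequence $\mathbf u$ of nonnegative integers, the distribution of $(h_0,h_1,\dots,h_k)$ over $\mathcal P^k(T,B,\mathbf u)$ is symmetric: for every permutation $\pi$ of $\{0,\dots,k\}$, $$\sum_{\mathbf P\in\mathcal P^k(T,B,\mathbf u)}\prod_{i=0}^k z_i^{h_i(\mathbf P)}=\sum_{\mathbf P\in\mathcal P^k(T,B,\mathbf u)}\prod_{i=0}^k z_i^{h_{\pi(i)}(\mathbf P)}.$$
   Context: $T$ weakly above $B$ means no point of $T$ is strictly below or strictly to the right of $B$. $\mathcal P(T,B)$ is the set of lattice paths with steps $N,E$ from the origin to $(x,y)$ weakly above $B$ and weakly below $T$. $\mathcal P^k(T,B)$ is the set of $k$-tuples $\mathbf P=(P_1,\dots,P_k)$ of paths in $\mathcal P(T,B)$ with $P_i$ weakly above $P_{i+1}$. With $P_0=T$, $P_{k+1}=B$, $h_i(\mathbf P)$ ($0\le i\le k$) is the number of east steps on which $P_i$ and $P_{i+1}$ coincide. For $1\le s\le y-1$, $u_s(\mathbf P)$ is the number of unit east steps of the lattice with $y$-coordinate $y-s$ that lie strictly between $T$ and $B$ and are not used by any of $P_1,\dots,P_k$; $\mathbf u(\mathbf P)=(u_1,u_2,\dots)$, and $\mathcal P^k(T,B,\mathbf u)=\{\mathbf P\in\mathcal P^k(T,B):\mathbf u(\mathbf P)=\mathbf u\}$. -}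

module Defs where

open import Data.Nat using (ℕ; zero; suc; _∸_; _≡ᵇ_; _<ᵇ_; _≤ᵇ_)
open import Data.Bool using (Bool; true; false; _∧_; _∨_; not; if_then_else_)
open import Data.List using (List; []; _∷_; map; _++_; concatMap; filterᵇ; length; upTo)
open import Data.Bool.ListAction using (all; any; and)
open import Data.Product using (_×_; _,_)
open import Data.Fin using (Fin; inject₁; suc; zero)
open import Data.Vec using (Vec; []; _∷_; lookup; _∷ʳ_; toList)
open import Relation.Binary.PropositionalEquality using (_≡_)
open import Algebra.Bundles using (CommutativeSemiring)

data Step : Set where
  N E : Step

Path : Set
Path = List Step

countE countN : Path → ℕ
countE [] = 0
countE (E ∷ s) = suc (countE s)
countE (N ∷ s) = countE s
countN [] = 0
countN (N ∷ s) = suc (countN s)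
countN (E ∷ s) = countN s

EndsAt : ℕ → ℕ → Path → Set
EndsAt x y P = (countE P ≡ x) × (countN P ≡ y)

paths : ℕ → ℕ → List Path
paths zero zero = [] ∷ []
paths (suc x) zero = map (E ∷_) (paths x zero)
paths zero (suc y) = map (N ∷_) (paths zero y)
paths (suc x) (suc y) = map (E ∷_) (paths x (suc y)) ++ map (N ∷_) (paths (suc x) y)

-- A unit east step of the lattice from (a , c) to (a+1 , c) is coded by (a , c).
EastStep : Set
EastStep = ℕ × ℕ

eastStepsFrom : ℕ → ℕ → Path → List EastStep
eastStepsFrom a c [] = []
eastStepsFrom a c (E ∷ s) = (a , c) ∷ eastStepsFrom (suc a) c s
eastStepsFrom a c (N ∷ s) = eastStepsFrom a (suc c) s

eastSteps : Path → List EastStep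
eastSteps = eastStepsFrom 0 0

_==ₑ_ : EastStep → EastStep → Bool
(a , c) ==ₑ (a' , c') = (a ≡ᵇ a') ∧ (c ≡ᵇ c')

usesᵇ : Path → EastStep → Bool
usesᵇ P e = any (e ==ₑ_) (eastSteps P)

-- P weakly above Q (for paths with the same endpoint): in every column a,
-- the east step of P lies at height ≥ that of the east step of Q; i.e. no
-- point of P is strictly below / strictly to the right of Q.
weaklyAboveᵇ : Path → Path → Bool
weaklyAboveᵇ P Q =
  all (λ { (a , c) → all (λ { (a' , c') → not (a ≡ᵇ a') ∨ (c' ≤ᵇ c) }) (eastSteps Q) })
      (eastSteps P)

WeaklyAbove : Path → Path → Set
WeaklyAbove P Q = weaklyAboveᵇ P Q ≡ true

-- The unit east step (a , c) lies strictly between T and B: its interior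
-- is strictly below T and strictly above B, i.e. in column a the east step
-- of T is strictly higher than c and that of B strictly lower than c.
strictlyBetweenᵇ : Path → Path → EastStep → Bool
strictlyBetweenᵇ T B (a , c) =
  all (λ { (a' , c') → not (a ≡ᵇ a') ∨ (c <ᵇ c') }) (eastSteps T) ∧
  all (λ { (a' , c') → not (a ≡ᵇ a') ∨ (c' <ᵇ c) }) (eastSteps B)

tuples : ℕ → ℕ → (k : ℕ) → List (Vec Path k)
tuples x y zero = [] ∷ []
tuples x y (suc k) = concatMap (λ P → map (P ∷_) (tuples x y k)) (paths x y)

chainᵇ : {k : ℕ} → Path → Vec Path k → Bool
chainᵇ prev [] = true
chainᵇ prev (P ∷ Ps) = weaklyAboveᵇ prev P ∧ chainᵇ P Ps

allWeaklyBetweenᵇ : {k : ℕ} → Path → Path → Vec Path k → Bool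
allWeaklyBetweenᵇ T B Ps =
  and (map (λ P → weaklyAboveᵇ T P ∧ weaklyAboveᵇ P B) (toList Ps))

extended : {k : ℕ} → Path → Path → Vec Path k → Vec Path (suc (suc k))
extended T B Ps = T ∷ (Ps ∷ʳ B)

h : {k : ℕ} → Path → Path → Vec Path k → Fin (suc k) → ℕ
h T B Ps i = length (filterᵇ (usesᵇ Q) (eastSteps P))
  where
  P = lookup (extended T B Ps) (inject₁ i)
  Q = lookup (extended T B Ps) (suc i)

uₛ : {k : ℕ} → ℕ → ℕ → Path → Path → Vec Path k → ℕ → ℕ
uₛ x y T B Ps s =
  length (filterᵇ (λ a → strictlyBetweenᵇ T B (a , y ∸ s) ∧
                         not (any (λ P → usesᵇ P (a , y ∸ s)) (toList Ps)))
                  (upTo x))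

uVec : {k : ℕ} → ℕ → ℕ → Path → Path → Vec Path k → List ℕ
uVec x y T B Ps = map (λ j → uₛ x y T B Ps (suc j)) (upTo (y ∸ 1))

_==ℕs_ : List ℕ → List ℕ → Bool
[] ==ℕs [] = true
(m ∷ ms) ==ℕs (n ∷ ns) = (m ≡ᵇ n) ∧ (ms ==ℕs ns)
_ ==ℕs _ = false

-- 𝒫^k(T,B,𝐮), enumerated as a duplicate-free list
𝒫ᵏ : ℕ → ℕ → (k : ℕ) → Path → Path → List ℕ → List (Vec Path k)
𝒫ᵏ x y k T B u =
  filterᵇ (λ Ps → allWeaklyBetweenᵇ T B Ps ∧ chainᵇ T Ps ∧ (uVec x y T B Ps ==ℕs u))
          (tuples x y k)

module _ {c ℓ} (R : CommutativeSemiring c ℓ) where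
  open CommutativeSemiring R using (Carrier; _+_; _*_; 0#; 1#; rawSemiring)
  open import Algebra.Definitions.RawSemiring rawSemiring using (_^_)

  ∏ : (n : ℕ) → (Fin n → Carrier) → Carrier
  ∏ zero f = 1#
  ∏ (suc n) f = f zero * ∏ n (λ i → f (suc i))

  ∑ : {A : Set} → List A → (A → Carrier) → Carrier
  ∑ [] f = 0#
  ∑ (a ∷ as) f = f a + ∑ as f

  genFun : (x y k : ℕ) → Path → Path → List ℕ →
           (Fin (suc k) → Carrier) → (Fin (suc k) → Fin (suc k)) → Carrier
  genFun x y k T B u z σ =
    ∑ (𝒫ᵏ x y k T B u) (λ Ps → ∏ (suc k) (λ i → z i ^ h T B Ps (σ i)))

{-# OPTIONS --safe #-}

-- An east step is recorded by its depth y − (height), so that a path becomes a weakly decreasing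
-- sequence.  If one path P of a chain varies between its two neighbours L and U, only two of the hᵢ
-- change, and 𝐮 changes by the multiset of depths at which P touches neither neighbour.  So it is
-- enough that, for fixed L and U, exchanging the two contact numbers preserves the distribution
-- refined by those depths; adjacent transpositions then generate all permutations.
--
-- Write a, b and v r for the marks of a contact with L, of a contact with U and of another step at
-- depth r.  Let f q be the formal sum of the marked paths with depths ≤ q, f′ q the same sum with a
-- and b exchanged, and g r the sum for U cut off at depth r.  The relations
--     b f′(q) + a g(q+1) = a f(q) + b g(q+1),
--     v r f(r) + b g(r+1) + a g(r) = v r f′(r) + a g(r+1) + b g(r)
-- and the symmetry of g survive the addition of a column on the left, and f = g = f′ at full depth.
module Submission where

open import Defs
open import Data.Nat using (ℕ; zero; suc; pred; _+_; _∸_; _≤_; _<_; _≥_; _⊓_; _≡ᵇ_; _≤ᵇ_; _<ᵇ_; z≤n; s≤s)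
open import Data.Nat.Properties
open import Data.Bool using (Bool; true; false; _∧_; _∨_; not; if_then_else_)
open import Data.Bool.ListAction using (all; any)
open import Data.Bool.Properties using (∧-identityˡ; ∧-identityʳ; ∨-identityˡ; ∨-identityʳ)
open import Data.List using (List; []; _∷_; map; _++_; filterᵇ; concatMap; foldr; length; upTo; applyUpTo)
open import Data.List.Properties using (map-++; map-∘; map-cong; map-cong-local; ++-identityʳ)
open import Data.List.Relation.Binary.Permutation.Propositional
open import Data.List.Relation.Binary.Permutation.Propositional.Properties
  using (map⁺; ++⁺; ++⁺ˡ; ++⁺ʳ; ++-comm; drop-∷; ++-commutativeMonoid)
open import Data.List.Relation.Unary.All as All using (All; []; _∷_)
import Data.List.Relation.Unary.All.Properties as All
open import Data.Vec as Vec using (Vec; []; _∷_; toList)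
open import Data.Vec.Relation.Binary.Pointwise.Inductive as Pointwise using (Pointwise; []; _∷_)
open import Data.Vec.Relation.Unary.All as VAll using ([]; _∷_) renaming (All to VAll)
open import Data.Fin as Fin using (Fin; zero; suc)
open import Data.Fin.Permutation using (Permutation′; _⟨$⟩ʳ_; lift₀-transpose)
import Data.Fin.Permutation.Components as PC
open import Data.Fin.Permutation.Transposition.List using (TranspositionList; eval; decompose; eval-decompose)
open import Data.Product using (_×_; _,_; proj₁; proj₂)
open import Data.Sum using (inj₁; inj₂)
open import Function using (_∘_; id)
open import Function.Bundles using (mk⇔)
open import Relation.Nullary using (Dec; yes; no; contradiction)
open import Relation.Nullary.Decidable using (does; dec-true; dec-false; does-⇔; map′; _×-dec_)
open import Relation.Binary using (tri<; tri≈; tri>)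
open import Relation.Binary.PropositionalEquality
  using (_≡_; _≢_; _≗_; cong; cong₂; subst; subst₂; ≢-sym; module ≡-Reasoning)
  renaming (refl to ≡-refl; sym to ≡-sym; trans to ≡-trans)
open import Algebra.Bundles using (CommutativeSemiring)
import Algebra.Properties.CommutativeSemigroup
import Algebra.Solver.CommutativeMonoid
open import Level using (Level)

-- Exchanging the marks of the two boundaries

-- Formal sums are lists up to permutation, so a common summand cancels. This stands in for
-- subtraction when relations are combined.
++-cancelˡ-↭ : {A : Set} (xs : List A) {ys zs : List A} → xs ++ ys ↭ xs ++ zs → ys ↭ zs
++-cancelˡ-↭ []       p = p
++-cancelˡ-↭ (x ∷ xs) p = ++-cancelˡ-↭ xs (drop-∷ p)

map-swap : {A : Set} {f g : A → A} → (∀ s → f (g s) ≡ g (f s)) → (xs : List A) →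
           map f (map g xs) ≡ map g (map f xs)
map-swap {f = f} {g} fg xs = begin
  map f (map g xs) ≡⟨ map-∘ xs ⟨
  map (f ∘ g) xs   ≡⟨ map-cong fg xs ⟩
  map (g ∘ f) xs   ≡⟨ map-∘ xs ⟩
  map g (map f xs) ∎
  where open ≡-Reasoning

window : ℕ → ℕ → ℕ → Bool
window l u p = (l ≤ᵇ p) ∧ (p ≤ᵇ u)

accum : {A : Set} → (ℕ → List A) → ℕ → List A
accum g zero    = g 0
accum g (suc q) = g (suc q) ++ accum g q

module Column {A : Set} (a b : A → A) (v : ℕ → A → A) where

  mark : ℕ → ℕ → ℕ → A → A
  mark l u p = if l ≡ᵇ p then (if p ≡ᵇ u then a ∘ b else a)
                         else (if p ≡ᵇ u then b else v p)

  layer : ℕ → ℕ → (ℕ → List A) → ℕ → List A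
  layer l u f p = if window l u p then map (mark l u p) (f p) else []

  -- Read `f p` as the marked sequences with depths at most `p` in the remaining columns. A new
  -- first depth `p` bounds all later ones, hence `f p` in layer `p`; the partial sum restricts the
  -- first depth to at most `q`.
  extend : ℕ → ℕ → (ℕ → List A) → ℕ → List A
  extend l u f = accum (layer l u f)

  module _ {l u : ℕ} (f : ℕ → List A) where

    layer-inside : ∀ {p} → l ≤ p → p ≤ u → layer l u f p ≡ map (mark l u p) (f p)
    layer-inside {p} l≤p p≤u
      rewrite dec-true (l ≤? p) l≤p | dec-true (p ≤? u) p≤u = ≡-refl

    layer-below : ∀ {p} → p < l → layer l u f p ≡ []
    layer-below {p} p<l rewrite dec-false (l ≤? p) (<⇒≱ p<l) = ≡-refl

    layer-above : ∀ {p} → u < p → layer l u f p ≡ []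
    layer-above {p} u<p rewrite dec-false (p ≤? u) (<⇒≱ u<p) with l ≤ᵇ p
    ... | true  = ≡-refl
    ... | false = ≡-refl

    extend-below : ∀ {q} → q < l → extend l u f q ≡ []
    extend-below {zero}  q<l = layer-below q<l
    extend-below {suc q} q<l = cong₂ _++_ (layer-below q<l) (extend-below (<-trans (n<1+n q) q<l))

    private
      -- The separate index `p` allows a case split that makes `accum` compute while `l` stays a
      -- parameter.
      extend-first : ∀ p → p ≡ l → extend l u f p ≡ layer l u f p
      extend-first zero    p≡l = ≡-refl
      extend-first (suc p) p≡l =
        ≡-trans (cong (layer l u f (suc p) ++_) (extend-below (≤-reflexive p≡l))) (++-identityʳ _)

    extend-start : l < u → extend l u f l ≡ map a (f l)
    extend-start l<u = ≡-trans (extend-first l ≡-refl) (≡-trans (layer-inside ≤-refl (<⇒≤ l<u)) marked)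
      where
      marked : map (mark l u l) (f l) ≡ map a (f l)
      marked rewrite dec-true (l ≟ l) ≡-refl | dec-false (l ≟ u) (<⇒≢ l<u) = ≡-refl

    extend-inner : ∀ {q} → l < suc q → suc q < u →
                   extend l u f (suc q) ≡ map (v (suc q)) (f (suc q)) ++ extend l u f q
    extend-inner {q} l<p p<u =
      cong (_++ extend l u f q) (≡-trans (layer-inside (<⇒≤ l<p) (<⇒≤ p<u)) marked)
      where
      marked : map (mark l u (suc q)) (f (suc q)) ≡ map (v (suc q)) (f (suc q))
      marked rewrite dec-false (l ≟ suc q) (<⇒≢ l<p) | dec-false (suc q ≟ u) (<⇒≢ p<u) = ≡-refl

    extend-end : ∀ {p} → l < p → p ≡ u → extend l u f p ≡ map b (f p) ++ extend l u f (pred p)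
    extend-end {suc q} l<p p≡u =
      cong (_++ extend l u f q) (≡-trans (layer-inside (<⇒≤ l<p) (≤-reflexive p≡u)) marked)
      where
      marked : map (mark l u (suc q)) (f (suc q)) ≡ map b (f (suc q))
      marked rewrite dec-false (l ≟ suc q) (<⇒≢ l<p) | dec-true (suc q ≟ u) p≡u = ≡-refl

    extend-single : l ≡ u → extend l u f l ≡ map (a ∘ b) (f l)
    extend-single l≡u = ≡-trans (extend-first l ≡-refl) (≡-trans (layer-inside ≤-refl (≤-reflexive l≡u)) marked)
      where
      marked : map (mark l u l) (f l) ≡ map (a ∘ b) (f l)
      marked rewrite dec-true (l ≟ l) ≡-refl | dec-true (l ≟ u) l≡u = ≡-refl

    extend-above : ∀ {q} → u ≤ q → extend l u f q ≡ extend l u f u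
    extend-above {q} u≤q with m≤n⇒m<n∨m≡n u≤q
    ... | inj₂ ≡-refl = ≡-refl
    extend-above {suc q} u≤q | inj₁ (s≤s u≤q′) =
      ≡-trans (cong (_++ extend l u f q) (layer-above (s≤s u≤q′))) (extend-above u≤q′)

module Exchange {A : Set} (a b : A → A) (v : ℕ → A → A)
                (ab : ∀ s → a (b s) ≡ b (a s))
                (av : ∀ p s → a (v p s) ≡ v p (a s))
                (bv : ∀ p s → b (v p s) ≡ v p (b s)) where

  open Algebra.Solver.CommutativeMonoid (++-commutativeMonoid {A = A}) using (solve; _⊜_; _⊕_)
  open PermutationReasoning
  module F = Column a b v
  module F′ = Column b a v

  -- g r plays the role of the sum over the region whose lower boundary is cut off at depth r.
  record Related (l u : ℕ) (f f′ : ℕ → List A) : Set where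
    field
      g     : ℕ → List A
      top   : ∀ {q} → u ≤ q → f q ↭ g q
      top′  : ∀ {q} → u ≤ q → f′ q ↭ g q
      slope : ∀ {q} → l ≤ q →
              map b (f′ q) ++ map a (g (suc q)) ↭ map a (f q) ++ map b (g (suc q))
      bend  : ∀ {r} → l < r →
              map (v r) (f r) ++ map b (g (suc r)) ++ map a (g r) ↭
              map (v r) (f′ r) ++ map a (g (suc r)) ++ map b (g r)

  -- Once `f q`, `f′ q` and `g (suc q)` are the same multiset, `slope` is only commutativity.
  -- `bend-flat` is the analogue for `bend`.
  slope-flat : ∀ {xs ys zs : List A} → xs ↭ zs → ys ↭ zs →
               map b ys ++ map a zs ↭ map a xs ++ map b zs
  slope-flat {xs} {ys} {zs} xs↭zs ys↭zs = begin
    map b ys ++ map a zs ↭⟨ ++⁺ʳ _ (map⁺ b ys↭zs) ⟩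
    map b zs ++ map a zs ↭⟨ ++-comm (map b zs) (map a zs) ⟩
    map a zs ++ map b zs ↭⟨ ++⁺ʳ _ (map⁺ a xs↭zs) ⟨
    map a xs ++ map b zs ∎

  bend-flat : ∀ {r} {xs ys zs ws : List A} → xs ↭ ys → zs ↭ ws →
              map (v r) xs ++ map b zs ++ map a ws ↭ map (v r) ys ++ map a zs ++ map b ws
  bend-flat {r} {xs} {ys} {zs} {ws} xs↭ys zs↭ws = ++⁺ (map⁺ (v r) xs↭ys) (begin
    map b zs ++ map a ws ↭⟨ ++⁺ (map⁺ b zs↭ws) (map⁺ a (↭-sym zs↭ws)) ⟩
    map b ws ++ map a zs ↭⟨ ++-comm (map b ws) (map a zs) ⟩
    map a zs ++ map b ws ∎)

  -- Base case: with no columns left, the score list does not depend on the depth bound.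
  related-const : ∀ {l u} (xs : List A) → Related l u (λ _ → xs) (λ _ → xs)
  related-const xs = record
    { g     = λ _ → xs
    ; top   = λ _ → refl
    ; top′  = λ _ → refl
    ; slope = λ _ → slope-flat {xs} refl refl
    ; bend  = λ _ → bend-flat {xs = xs} {zs = xs} refl refl
    }

  module _ {l u : ℕ} {f f′ : ℕ → List A} (rel : Related l u f f′) where

    open Related rel

    -- Induction on `q` from `l`. At `q = l` the new column only offers a contact with the boundary
    -- at `l`, and the claim is `slope`; each further depth adds a `v` layer on both sides, which
    -- `bend` balances.
    crossing : ∀ {q} → l ≤ q → q < u →
               F.extend l u f q ++ map b (g (suc q)) ↭ F′.extend l u f′ q ++ map a (g (suc q))
    crossing {q} l≤q q<u with m≤n⇒m<n∨m≡n l≤q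
    ... | inj₂ ≡-refl = begin
      F.extend l u f l ++ map b (g (suc l))   ≡⟨ cong (_++ map b (g (suc l))) (F.extend-start f q<u) ⟩
      map a (f l) ++ map b (g (suc l))        ↭⟨ slope ≤-refl ⟨
      map b (f′ l) ++ map a (g (suc l))       ≡⟨ cong (_++ map a (g (suc l))) (F′.extend-start f′ q<u) ⟨
      F′.extend l u f′ l ++ map a (g (suc l)) ∎
    crossing {suc q} _ q<u | inj₁ l<q@(s≤s l≤q) =
      subst₂ (λ xs ys → xs ++ bH ↭ ys ++ aH)
             (≡-sym (F.extend-inner f l<q q<u)) (≡-sym (F′.extend-inner f′ l<q q<u))
             -- The sum of the induction hypothesis and `bend` has `bG ++ aG` in excess on both
             -- sides.
             (++-cancelˡ-↭ (bG ++ aG) (begin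
        (bG ++ aG) ++ (vf ++ X) ++ bH
          ↭⟨ solve 5 (λ bG aG vf X bH → (bG ⊕ aG) ⊕ ((vf ⊕ X) ⊕ bH) ⊜ (X ⊕ bG) ⊕ (vf ⊕ (bH ⊕ aG)))
                   refl bG aG vf X bH ⟩
        (X ++ bG) ++ vf ++ bH ++ aG
          ↭⟨ ++⁺ (crossing l≤q (<-trans (n<1+n q) q<u)) (bend l<q) ⟩
        (X′ ++ aG) ++ vf′ ++ aH ++ bG
          ↭⟨ solve 5 (λ X′ aG vf′ aH bG → (X′ ⊕ aG) ⊕ (vf′ ⊕ (aH ⊕ bG)) ⊜ (bG ⊕ aG) ⊕ ((vf′ ⊕ X′) ⊕ aH))
                   refl X′ aG vf′ aH bG ⟩
        (bG ++ aG) ++ (vf′ ++ X′) ++ aH ∎))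
      where
      X   = F.extend l u f q
      X′  = F′.extend l u f′ q
      aG  = map a (g (suc q))
      bG  = map b (g (suc q))
      aH  = map a (g (suc (suc q)))
      bH  = map b (g (suc (suc q)))
      vf  = map (v (suc q)) (f (suc q))
      vf′ = map (v (suc q)) (f′ (suc q))

    -- With `l = u` the new column is forced and touches both boundaries, so all three families are
    -- the constant `K` from depth `l` on.
    related-extend-single : l ≡ u → Related l u (F.extend l u f) (F′.extend l u f′)
    related-extend-single l≡u = record
      { g     = λ _ → K
      ; top   = flat
      ; top′  = flat′
      ; slope = λ l≤q → slope-flat {zs = K} (flat (u≤ l≤q)) (flat′ (u≤ l≤q))
      ; bend  = λ l<r → bend-flat {zs = K} (↭-trans (flat (u≤ (<⇒≤ l<r))) (↭-sym (flat′ (u≤ (<⇒≤ l<r))))) refl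
      }
      where
      K = map (a ∘ b) (g l)
      u≤ : ∀ {q} → l ≤ q → u ≤ q
      u≤ = subst (_≤ _) l≡u
      flat : ∀ {q} → u ≤ q → F.extend l u f q ↭ K
      flat {q} u≤q = begin
        F.extend l u f q  ≡⟨ F.extend-above {l} f u≤q ⟩
        F.extend l u f u  ≡⟨ cong (F.extend l u f) l≡u ⟨
        F.extend l u f l  ≡⟨ F.extend-single f l≡u ⟩
        map (a ∘ b) (f l) ↭⟨ map⁺ (a ∘ b) (top (u≤ ≤-refl)) ⟩
        K ∎
      flat′ : ∀ {q} → u ≤ q → F′.extend l u f′ q ↭ K
      flat′ {q} u≤q = begin
        F′.extend l u f′ q ≡⟨ F′.extend-above {l} f′ u≤q ⟩
        F′.extend l u f′ u ≡⟨ cong (F′.extend l u f′) l≡u ⟨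
        F′.extend l u f′ l ≡⟨ F′.extend-single f′ l≡u ⟩
        map (b ∘ a) (f′ l) ↭⟨ map⁺ (b ∘ a) (top′ (u≤ ≤-refl)) ⟩
        map (b ∘ a) (g l)  ≡⟨ map-cong (λ s → ≡-sym (ab s)) (g l) ⟩
        K ∎

    module _ (l<u : l < u) where

      -- The sum for a lower boundary that passes the new column at depth `m`: the first depth is
      -- either smaller than `m`, or equal to `m` and marked as a contact. The value of `pred 0` is
      -- harmless, as `l < m` in every relation used.
      capped : ℕ → List A
      capped m = F.extend l u f (pred m) ++ map b (g m)

      capped′ : ℕ → List A
      capped′ m = F′.extend l u f′ (pred m) ++ map a (g m)

      -- A cut-off at depth `u` or deeper changes nothing, hence `r ⊓ u`.
      g⁺ : ℕ → List A
      g⁺ r = capped (r ⊓ u)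

      -- This is the symmetry of the cut-off sums in `a` and `b`; `crossing` is shaped to be exactly
      -- it.
      capped↭capped′ : ∀ {m} → l < m → m ≤ u → capped m ↭ capped′ m
      capped↭capped′ (s≤s l≤q) q<u = crossing l≤q q<u

      g⁺-below : ∀ {r} → r ≤ u → g⁺ r ≡ capped r
      g⁺-below r≤u = cong capped (m≤n⇒m⊓n≡m r≤u)

      g⁺-above : ∀ {r} → u ≤ r → g⁺ r ≡ capped u
      g⁺-above u≤r = cong capped (m≥n⇒m⊓n≡n u≤r)

      extend-full : F.extend l u f u ↭ capped u
      extend-full = begin
        F.extend l u f u                        ≡⟨ F.extend-end f l<u ≡-refl ⟩
        map b (f u) ++ F.extend l u f (pred u)  ↭⟨ ++-comm (map b (f u)) _ ⟩
        F.extend l u f (pred u) ++ map b (f u)  ↭⟨ ++⁺ˡ _ (map⁺ b (top ≤-refl)) ⟩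
        capped u ∎

      extend-full′ : F′.extend l u f′ u ↭ capped u
      extend-full′ = begin
        F′.extend l u f′ u                        ≡⟨ F′.extend-end f′ l<u ≡-refl ⟩
        map a (f′ u) ++ F′.extend l u f′ (pred u) ↭⟨ ++-comm (map a (f′ u)) _ ⟩
        F′.extend l u f′ (pred u) ++ map a (f′ u) ↭⟨ ++⁺ˡ _ (map⁺ a (top′ ≤-refl)) ⟩
        capped′ u                                 ↭⟨ capped↭capped′ l<u ≤-refl ⟨
        capped u ∎

      top⁺ : ∀ {q} → u ≤ q → F.extend l u f q ↭ capped u
      top⁺ u≤q = ↭-trans (↭-reflexive (F.extend-above {l} f u≤q)) extend-full

      top⁺′ : ∀ {q} → u ≤ q → F′.extend l u f′ q ↭ capped u
      top⁺′ u≤q = ↭-trans (↭-reflexive (F′.extend-above {l} f′ u≤q)) extend-full′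

      -- By the symmetry of `capped`, both sides equal `a X + b X′ + a b H`.
      slope⁺ : ∀ {q} → l ≤ q → q < u →
               map b (F′.extend l u f′ q) ++ map a (capped (suc q)) ↭
               map a (F.extend l u f q) ++ map b (capped (suc q))
      slope⁺ {q} l≤q q<u = begin
        map b X′ ++ map a (X ++ map b H)        ≡⟨ cong (map b X′ ++_) (map-++ a X (map b H)) ⟩
        map b X′ ++ map a X ++ map a (map b H)
          ≡⟨ cong (λ xs → map b X′ ++ map a X ++ xs) (map-swap ab H) ⟩
        map b X′ ++ map a X ++ map b (map a H)
          ↭⟨ solve 3 (λ x y z → x ⊕ (y ⊕ z) ⊜ y ⊕ (x ⊕ z)) refl (map b X′) (map a X) (map b (map a H)) ⟩
        map a X ++ map b X′ ++ map b (map a H)  ≡⟨ cong (map a X ++_) (map-++ b X′ (map a H)) ⟨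
        map a X ++ map b (capped′ (suc q))
          ↭⟨ ++⁺ˡ (map a X) (map⁺ b (capped↭capped′ (s≤s l≤q) q<u)) ⟨
        map a X ++ map b (capped (suc q)) ∎
        where
        X  = F.extend l u f q
        X′ = F′.extend l u f′ q
        H  = g (suc q)

      -- After adding v r (b H) on both sides, H = g (suc r), this is the sum of crossing under v r,
      -- bend under b and slope under v r.
      bend⁺ : ∀ {r} → l < r → r < u →
              map (v r) (F.extend l u f r) ++ map b (capped (suc r)) ++ map a (capped r) ↭
              map (v r) (F′.extend l u f′ r) ++ map a (capped (suc r)) ++ map b (capped r)
      bend⁺ {suc q} l<r@(s≤s l≤q) r<u = ++-cancelˡ-↭ (V (map b H)) (begin
        V (map b H) ++ V Y ++ map b (Y ++ map b H) ++ map a (X ++ map b G)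
          ≡⟨ cong₂ (λ xs ys → V (map b H) ++ V Y ++ xs ++ ys)
                   (≡-trans (cong (λ xs → map b (xs ++ map b H)) Y≡)
                            (≡-trans (map-++ b (V f₀ ++ X) (map b H))
                                     (cong (_++ map b (map b H)) (map-++ b (V f₀) X))))
                   (map-++ a X (map b G)) ⟩
        V (map b H) ++ V Y ++ ((bvf ++ bX) ++ bbH) ++ aX ++ abG
          ≡⟨ cong (λ xs → V (map b H) ++ V Y ++ ((bvf ++ bX) ++ bbH) ++ aX ++ xs) (map-swap ab G) ⟩
        V (map b H) ++ V Y ++ ((bvf ++ bX) ++ bbH) ++ aX ++ baG
          ↭⟨ solve 7 (λ vbH vY bvf bX bbH aX baG →
                        vbH ⊕ (vY ⊕ (((bvf ⊕ bX) ⊕ bbH) ⊕ (aX ⊕ baG))) ⊜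
                        (vY ⊕ vbH) ⊕ ((bvf ⊕ (bbH ⊕ baG)) ⊕ (bX ⊕ aX)))
                   refl (V (map b H)) (V Y) bvf bX bbH aX baG ⟩
        (V Y ++ V (map b H)) ++ (bvf ++ bbH ++ baG) ++ bX ++ aX
          ↭⟨ ++⁺ crossed (++⁺ʳ (bX ++ aX) bent) ⟩
        (V Y′ ++ V (map a H)) ++ (bvf′ ++ baH ++ bbG) ++ bX ++ aX
          ↭⟨ solve 7 (λ vY′ vaH bvf′ baH bbG bX aX →
                        (vY′ ⊕ vaH) ⊕ ((bvf′ ⊕ (baH ⊕ bbG)) ⊕ (bX ⊕ aX)) ⊜
                        (bvf′ ⊕ vaH) ⊕ (vY′ ⊕ (aX ⊕ (baH ⊕ (bX ⊕ bbG)))))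
                   refl (V Y′) (V (map a H)) bvf′ baH bbG bX aX ⟩
        (bvf′ ++ V (map a H)) ++ V Y′ ++ aX ++ baH ++ bX ++ bbG
          ↭⟨ ++⁺ʳ _ sloped ⟩
        (avf ++ V (map b H)) ++ V Y′ ++ aX ++ baH ++ bX ++ bbG
          ↭⟨ solve 7 (λ avf vbH vY′ aX baH bX bbG →
                        (avf ⊕ vbH) ⊕ (vY′ ⊕ (aX ⊕ (baH ⊕ (bX ⊕ bbG)))) ⊜
                        vbH ⊕ (vY′ ⊕ (((avf ⊕ aX) ⊕ baH) ⊕ (bX ⊕ bbG))))
                   refl avf (V (map b H)) (V Y′) aX baH bX bbG ⟩
        V (map b H) ++ V Y′ ++ ((avf ++ aX) ++ baH) ++ bX ++ bbG
          ≡⟨ cong (λ xs → V (map b H) ++ V Y′ ++ ((avf ++ aX) ++ xs) ++ bX ++ bbG) (map-swap ab H) ⟨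
        V (map b H) ++ V Y′ ++ ((avf ++ aX) ++ abH) ++ bX ++ bbG
          ≡⟨ cong₂ (λ xs ys → V (map b H) ++ V Y′ ++ xs ++ ys)
                   (≡-trans (cong (λ xs → map a (xs ++ map b H)) Y≡)
                            (≡-trans (map-++ a (V f₀ ++ X) (map b H))
                                     (cong (_++ map a (map b H)) (map-++ a (V f₀) X))))
                   (map-++ b X (map b G)) ⟨
        V (map b H) ++ V Y′ ++ map a (Y ++ map b H) ++ map b (X ++ map b G) ∎)
        where
        V   = map (v (suc q))
        X   = F.extend l u f q
        Y   = F.extend l u f (suc q)
        Y′  = F′.extend l u f′ (suc q)
        G   = g (suc q)
        H   = g (suc (suc q))
        f₀  = f (suc q)
        f₀′ = f′ (suc q)
        aX = map a X
        bX = map b X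
        avf = map a (V f₀)
        bvf = map b (V f₀)
        bvf′ = map b (V f₀′)
        abG = map a (map b G)
        baG = map b (map a G)
        bbG = map b (map b G)
        abH = map a (map b H)
        baH = map b (map a H)
        bbH = map b (map b H)
        Y≡ : Y ≡ V f₀ ++ X
        Y≡ = F.extend-inner f l<r r<u
        crossed : V Y ++ V (map b H) ↭ V Y′ ++ V (map a H)
        crossed = begin
          V Y ++ V (map b H)   ≡⟨ map-++ (v (suc q)) Y (map b H) ⟨
          V (Y ++ map b H)     ↭⟨ map⁺ (v (suc q)) (crossing (<⇒≤ l<r) r<u) ⟩
          V (Y′ ++ map a H)    ≡⟨ map-++ (v (suc q)) Y′ (map a H) ⟩
          V Y′ ++ V (map a H)  ∎
        map₃ : ∀ xs ys zs → map b (xs ++ ys ++ zs) ≡ map b xs ++ map b ys ++ map b zs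
        map₃ xs ys zs = ≡-trans (map-++ b xs (ys ++ zs)) (cong (map b xs ++_) (map-++ b ys zs))
        bent : bvf ++ bbH ++ baG ↭ bvf′ ++ baH ++ bbG
        bent = begin
          bvf ++ bbH ++ baG                      ≡⟨ map₃ (V f₀) (map b H) (map a G) ⟨
          map b (V f₀ ++ map b H ++ map a G)     ↭⟨ map⁺ b (bend l<r) ⟩
          map b (V f₀′ ++ map a H ++ map b G)    ≡⟨ map₃ (V f₀′) (map a H) (map b G) ⟩
          bvf′ ++ baH ++ bbG ∎
        sloped : bvf′ ++ V (map a H) ↭ avf ++ V (map b H)
        sloped = begin
          bvf′ ++ V (map a H)              ≡⟨ cong (_++ V (map a H)) (map-swap (bv (suc q)) f₀′) ⟩
          V (map b f₀′) ++ V (map a H)     ≡⟨ map-++ (v (suc q)) (map b f₀′) (map a H) ⟨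
          V (map b f₀′ ++ map a H)         ↭⟨ map⁺ (v (suc q)) (slope (<⇒≤ l<r)) ⟩
          V (map a f₀ ++ map b H)          ≡⟨ map-++ (v (suc q)) (map a f₀) (map b H) ⟩
          V (map a f₀) ++ V (map b H)      ≡⟨ cong (_++ V (map b H)) (map-swap (av (suc q)) f₀) ⟨
          avf ++ V (map b H) ∎

      related-extend-wide : Related l u (F.extend l u f) (F′.extend l u f′)
      related-extend-wide = record
        { g     = g⁺
        ; top   = λ u≤q → ↭-trans (top⁺ u≤q) (↭-reflexive (≡-sym (g⁺-above u≤q)))
        ; top′  = λ u≤q → ↭-trans (top⁺′ u≤q) (↭-reflexive (≡-sym (g⁺-above u≤q)))
        ; slope = slope-cases
        ; bend  = bend-cases
        }
        where
        slope-cases : ∀ {q} → l ≤ q →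
                      map b (F′.extend l u f′ q) ++ map a (g⁺ (suc q)) ↭
                      map a (F.extend l u f q) ++ map b (g⁺ (suc q))
        -- From depth `u` on all families equal `capped u`; only `q < u` needs an argument.
        slope-cases {q} l≤q with <-≤-connex q u
        ... | inj₁ q<u rewrite g⁺-below q<u = slope⁺ l≤q q<u
        ... | inj₂ u≤q rewrite g⁺-above (m≤n⇒m≤1+n u≤q) = slope-flat {zs = capped u} (top⁺ u≤q) (top⁺′ u≤q)
        bend-cases : ∀ {r} → l < r →
                     map (v r) (F.extend l u f r) ++ map b (g⁺ (suc r)) ++ map a (g⁺ r) ↭
                     map (v r) (F′.extend l u f′ r) ++ map a (g⁺ (suc r)) ++ map b (g⁺ r)
        bend-cases {r} l<r with <-≤-connex r u
        ... | inj₁ r<u rewrite g⁺-below r<u | g⁺-below (<⇒≤ r<u) = bend⁺ l<r r<u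
        ... | inj₂ u≤r rewrite g⁺-above (m≤n⇒m≤1+n u≤r) | g⁺-above u≤r =
          bend-flat {zs = capped u} (↭-trans (top⁺ u≤r) (↭-sym (top⁺′ u≤r))) refl

    related-extend : l ≤ u → Related l u (F.extend l u f) (F′.extend l u f′)
    related-extend l≤u with m≤n⇒m<n∨m≡n l≤u
    ... | inj₁ l<u = related-extend-wide l<u
    ... | inj₂ l≡u = related-extend-single l≡u

-- Depth sequences and their marked sums

seqs : ∀ x → ℕ → List (Vec ℕ x)
seqs zero    y       = [] ∷ []
seqs (suc x) zero    = map (0 ∷_) (seqs x 0)
seqs (suc x) (suc y) = map (suc y ∷_) (seqs x (suc y)) ++ seqs (suc x) y

data Decreasing : ∀ {x} → ℕ → Vec ℕ x → Set where
  []  : ∀ {m} → Decreasing m []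
  _∷_ : ∀ {x m d} {D : Vec ℕ x} → d ≤ m → Decreasing d D → Decreasing m (d ∷ D)

Decreasing-weaken : ∀ {x m n} {D : Vec ℕ x} → m ≤ n → Decreasing m D → Decreasing n D
Decreasing-weaken m≤n []           = []
Decreasing-weaken m≤n (d≤m ∷ decD) = ≤-trans d≤m m≤n ∷ decD

seqs-decreasing : ∀ x y → All (Decreasing y) (seqs x y)
seqs-decreasing zero    y       = [] ∷ []
seqs-decreasing (suc x) zero    = All.map⁺ (All.map (≤-refl ∷_) (seqs-decreasing x 0))
seqs-decreasing (suc x) (suc y) =
  All.++⁺ (All.map⁺ (All.map (≤-refl ∷_) (seqs-decreasing x (suc y))))
          (All.map (Decreasing-weaken (n≤1+n y)) (seqs-decreasing (suc x) y))

_≼_ : ∀ {x} → Vec ℕ x → Vec ℕ x → Set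
_≼_ = Pointwise _≤_

_≼?_ : ∀ {x} (D D′ : Vec ℕ x) → Dec (D ≼ D′)
_≼?_ = Pointwise.decidable _≤?_

_≼ᵇ_ : ∀ {x} → Vec ℕ x → Vec ℕ x → Bool
D ≼ᵇ D′ = does (D ≼? D′)

inside : ∀ {x} → Vec ℕ x → Vec ℕ x → Vec ℕ x → Bool
inside L U P = (L ≼ᵇ P) ∧ (P ≼ᵇ U)

inside-∷ : ∀ {x} l u p (L U P : Vec ℕ x) →
           inside (l ∷ L) (u ∷ U) (p ∷ P) ≡ window l u p ∧ inside L U P
inside-∷ l u p L U P with l ≤ᵇ p | p ≤ᵇ u | L ≼ᵇ P
... | true  | true  | _     = ≡-refl
... | true  | false | true  = ≡-refl
... | true  | false | false = ≡-refl
... | false | _     | _     = ≡-refl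

accum-cong : {A : Set} {g g′ : ℕ → List A} → (∀ p → g p ≡ g′ p) → ∀ q → accum g q ≡ accum g′ q
accum-cong g≡ zero    = g≡ 0
accum-cong g≡ (suc q) = cong₂ _++_ (g≡ (suc q)) (accum-cong g≡ q)

module Scores {A : Set} (a b : A → A) (v : ℕ → A → A) (ε : A) where
  open Column a b v

  score : ∀ {x} → Vec ℕ x → Vec ℕ x → Vec ℕ x → A
  score []      []      []      = ε
  score (l ∷ L) (u ∷ U) (p ∷ P) = mark l u p (score L U P)

  scores : ∀ {x} → Vec ℕ x → Vec ℕ x → ℕ → List A
  scores []      []      = λ _ → ε ∷ []
  scores (l ∷ L) (u ∷ U) = extend l u (scores L U)

  score-all : ∀ {x} → Vec ℕ x → Vec ℕ x → List (Vec ℕ x) → List A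
  score-all L U Ps = map (score L U) (filterᵇ (inside L U) Ps)

  score-all-++ : ∀ {x} (L U : Vec ℕ x) Ps Qs →
                 score-all L U (Ps ++ Qs) ≡ score-all L U Ps ++ score-all L U Qs
  score-all-++ L U []       Qs = ≡-refl
  score-all-++ L U (P ∷ Ps) Qs with inside L U P
  ... | true  = cong (score L U P ∷_) (score-all-++ L U Ps Qs)
  ... | false = score-all-++ L U Ps Qs

  -- The window condition on the first depth does not involve the tail, so prefixing `p` keeps all
  -- admissible tails or discards all of them.
  score-all-∷ : ∀ {x} l u p (L U : Vec ℕ x) Ps →
                score-all (l ∷ L) (u ∷ U) (map (p ∷_) Ps) ≡ layer l u (λ _ → score-all L U Ps) p
  score-all-∷ l u p L U []       with window l u p
  ... | true  = ≡-refl
  ... | false = ≡-refl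
  score-all-∷ l u p L U (P ∷ Ps) rewrite inside-∷ l u p L U P
    with ih ← score-all-∷ l u p L U Ps | window l u p | inside L U P
  ... | true  | true  = cong (mark l u p (score L U P) ∷_) ih
  ... | true  | false = ih
  ... | false | _     = ih

  -- `seqs` is ordered by decreasing first depth, the order in which `accum` adds its layers, so
  -- enumeration and recursion agree as lists.
  score-all-seqs : ∀ {x} (L U : Vec ℕ x) q → score-all L U (seqs x q) ≡ scores L U q
  score-all-seqs []      []      q       = ≡-refl
  score-all-seqs (l ∷ L) (u ∷ U) q = first q
    where
    first : ∀ q → score-all (l ∷ L) (u ∷ U) (seqs _ q) ≡ extend l u (scores L U) q
    step : ∀ q → score-all (l ∷ L) (u ∷ U) (map (q ∷_) (seqs _ q)) ≡ layer l u (scores L U) q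
    step q = ≡-trans (score-all-∷ l u q L U (seqs _ q))
                     (cong (λ xs → layer l u (λ _ → xs) q) (score-all-seqs L U q))
    first zero    = step 0
    first (suc q) = ≡-trans (score-all-++ (l ∷ L) (u ∷ U) (map (suc q ∷_) (seqs _ (suc q))) (seqs _ q))
                            (cong₂ _++_ (step (suc q)) (first q))

module _ {A : Set} (a b : A → A) (v : ℕ → A → A) (ε : A)
         (ab : ∀ s → a (b s) ≡ b (a s))
         (av : ∀ p s → a (v p s) ≡ v p (a s))
         (bv : ∀ p s → b (v p s) ≡ v p (b s)) where
  open Exchange a b v ab av bv
  module S = Scores a b v ε
  module S′ = Scores b a v ε

  -- The relations are claimed only from the thresholds on, so the thresholds may be raised. Since
  -- the boundaries decrease, this carries the relations from one column to the column on its left.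
  Related-weaken : ∀ {l u l′ u′ f f′} → l ≤ l′ → u ≤ u′ → Related l u f f′ → Related l′ u′ f f′
  Related-weaken l≤l′ u≤u′ rel = record
    { g     = g
    ; top   = top ∘ ≤-trans u≤u′
    ; top′  = top′ ∘ ≤-trans u≤u′
    ; slope = slope ∘ ≤-trans l≤l′
    ; bend  = bend ∘ ≤-<-trans l≤l′
    }
    where open Related rel

  related-scores : ∀ {x l u} {L U : Vec ℕ x} → Decreasing l L → Decreasing u U → L ≼ U →
                   Related l u (S.scores L U) (S′.scores L U)
  related-scores []           []           []            = related-const _
  related-scores (l′≤l ∷ decL) (u′≤u ∷ decU) (l′≤u′ ∷ L≼U) =
    Related-weaken l′≤l u′≤u (related-extend (related-scores decL decU L≼U) l′≤u′)

  -- The bound `y` cuts off nothing, so both sums are permutations of `g y`.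
  scores-exchange : ∀ {x y} {L U : Vec ℕ x} → Decreasing y L → Decreasing y U → L ≼ U →
                    S.score-all L U (seqs x y) ↭ S′.score-all L U (seqs x y)
  scores-exchange {x} {y} {L} {U} decL decU L≼U = begin
    S.score-all L U (seqs x y)  ≡⟨ S.score-all-seqs L U y ⟩
    S.scores L U y              ↭⟨ top ≤-refl ⟩
    g y                         ↭⟨ top′ ≤-refl ⟨
    S′.scores L U y             ≡⟨ S′.score-all-seqs L U y ⟨
    S′.score-all L U (seqs x y) ∎
    where
    open PermutationReasoning
    open Related (related-scores decL decU L≼U)

𝟙 : Bool → ℕ
𝟙 c = if c then 1 else 0

contacts : ∀ {x} → Vec ℕ x → Vec ℕ x → ℕ
contacts []      []      = 0
contacts (d ∷ D) (e ∷ D′) = 𝟙 (d ≡ᵇ e) + contacts D D′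

detached : ∀ {x} → Vec ℕ x → Vec ℕ x → Vec ℕ x → List ℕ
detached []      []      []      = []
detached (l ∷ L) (u ∷ U) (p ∷ P) =
  if l ≡ᵇ p then detached L U P else if p ≡ᵇ u then detached L U P else p ∷ detached L U P

Stat : Set
Stat = ℕ × ℕ × List ℕ

stat stat′ : ∀ {x} → Vec ℕ x → Vec ℕ x → Vec ℕ x → Stat
stat  L U P = contacts L P , contacts P U , detached L U P
stat′ L U P = contacts P U , contacts L P , detached L U P

private
  inc₁ inc₂ : Stat → Stat
  inc₁ (i , j , w) = suc i , j , w
  inc₂ (i , j , w) = i , suc j , w

  put : ℕ → Stat → Stat
  put p (i , j , w) = i , j , p ∷ w

  module T  = Scores inc₁ inc₂ put (0 , 0 , [])
  module T′ = Scores inc₂ inc₁ put (0 , 0 , [])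

  score≡stat : ∀ {x} (L U P : Vec ℕ x) → T.score L U P ≡ stat L U P
  score≡stat []      []      []      = ≡-refl
  score≡stat (l ∷ L) (u ∷ U) (p ∷ P) rewrite score≡stat L U P with l ≡ᵇ p | p ≡ᵇ u
  ... | true  | true  = ≡-refl
  ... | true  | false = ≡-refl
  ... | false | true  = ≡-refl
  ... | false | false = ≡-refl

  score≡stat′ : ∀ {x} (L U P : Vec ℕ x) → T′.score L U P ≡ stat′ L U P
  score≡stat′ []      []      []      = ≡-refl
  score≡stat′ (l ∷ L) (u ∷ U) (p ∷ P) rewrite score≡stat′ L U P with l ≡ᵇ p | p ≡ᵇ u
  ... | true  | true  = ≡-refl
  ... | true  | false = ≡-refl
  ... | false | true  = ≡-refl
  ... | false | false = ≡-refl

-- Instance of `scores-exchange` in which the marks raise two counters and extend a word. They act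
-- on different components, so they commute definitionally, and exchanging `a` with `b` exchanges
-- the counters.
stats-exchange : ∀ {x y} {L U : Vec ℕ x} → Decreasing y L → Decreasing y U → L ≼ U →
                 map (stat L U) (filterᵇ (inside L U) (seqs x y)) ↭
                 map (stat′ L U) (filterᵇ (inside L U) (seqs x y))
stats-exchange {x} {y} {L} {U} decL decU L≼U = begin
  map (stat L U) Ps     ≡⟨ map-cong (score≡stat L U) Ps ⟨
  map (T.score L U) Ps  ↭⟨ scores-exchange inc₁ inc₂ put (0 , 0 , []) (λ _ → ≡-refl) (λ _ _ → ≡-refl)
                             (λ _ _ → ≡-refl) decL decU L≼U ⟩
  map (T′.score L U) Ps ≡⟨ map-cong (score≡stat′ L U) Ps ⟩
  map (stat′ L U) Ps    ∎
  where
  open PermutationReasoning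
  Ps = filterᵇ (inside L U) (seqs x y)

between : ∀ {x} → ℕ → Vec ℕ x → Vec ℕ x → ℕ
between s []      []      = 0
between s (d ∷ D) (e ∷ D′) = 𝟙 ((d <ᵇ s) ∧ (s <ᵇ e)) + between s D D′

count : ℕ → List ℕ → ℕ
count s []       = 0
count s (p ∷ ps) = 𝟙 (p ≡ᵇ s) + count s ps

open Algebra.Properties.CommutativeSemigroup +-commutativeSemigroup using () renaming (interchange to +-interchange)

-- A depth strictly between `l` and `u` lies on one side of `p` or equals it; in the last case `p`
-- touches neither boundary.
between-column : ∀ {l p u} s → l ≤ p → p ≤ u →
                 (𝟙 ((l <ᵇ s) ∧ (s <ᵇ p)) + 𝟙 ((p <ᵇ s) ∧ (s <ᵇ u)))
                   + (if l ≡ᵇ p then 0 else if p ≡ᵇ u then 0 else 𝟙 (p ≡ᵇ s))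
                 ≡ 𝟙 ((l <ᵇ s) ∧ (s <ᵇ u))
between-column {l} {p} {u} s l≤p p≤u with <-cmp s p
... | tri< s<p s≢p p≮s
  rewrite dec-true (s <? p) s<p | dec-false (p <? s) p≮s | dec-true (s <? u) (<-≤-trans s<p p≤u)
        | dec-false (p ≟ s) (≢-sym s≢p)
  with l <ᵇ s | l ≡ᵇ p | p ≡ᵇ u
... | true  | true  | _     = ≡-refl
... | true  | false | true  = ≡-refl
... | true  | false | false = ≡-refl
... | false | true  | _     = ≡-refl
... | false | false | true  = ≡-refl
... | false | false | false = ≡-refl
between-column {l} {p} {u} s l≤p p≤u | tri> s≮p s≢p p<s
  rewrite dec-false (s <? p) s≮p | dec-true (p <? s) p<s | dec-true (l <? s) (≤-<-trans l≤p p<s)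
        | dec-false (p ≟ s) (≢-sym s≢p)
  with s <ᵇ u | l ≡ᵇ p | p ≡ᵇ u
... | true  | true  | _     = ≡-refl
... | true  | false | true  = ≡-refl
... | true  | false | false = ≡-refl
... | false | true  | _     = ≡-refl
... | false | false | true  = ≡-refl
... | false | false | false = ≡-refl
between-column {l} {p} {u} s l≤p p≤u | tri≈ s≮s ≡-refl _
  rewrite dec-false (s <? s) s≮s | dec-true (s ≟ s) ≡-refl
  with m≤n⇒m<n∨m≡n l≤p | m≤n⇒m<n∨m≡n p≤u
... | inj₂ ≡-refl | _ rewrite dec-true (s ≟ s) ≡-refl | dec-false (s <? s) s≮s = ≡-refl
... | inj₁ l<s | inj₂ ≡-refl
  rewrite dec-false (l ≟ s) (<⇒≢ l<s) | dec-true (s ≟ s) ≡-refl | dec-true (l <? s) l<s | dec-false (s <? s) s≮s = ≡-refl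
... | inj₁ l<s | inj₁ s<u
  rewrite dec-false (l ≟ s) (<⇒≢ l<s) | dec-false (s ≟ u) (<⇒≢ s<u) | dec-true (l <? s) l<s | dec-true (s <? u) s<u = ≡-refl

between-detached : ∀ {x} s {L P U : Vec ℕ x} → L ≼ P → P ≼ U →
                   (between s L P + between s P U) + count s (detached L U P) ≡ between s L U
between-detached s []            []            = ≡-refl
between-detached s {l ∷ L} {p ∷ P} {u ∷ U} (l≤p ∷ L≼P) (p≤u ∷ P≼U) = begin
  (i₁ + b₁) + (i₂ + b₂) + count s (detached (l ∷ L) (u ∷ U) (p ∷ P))
    ≡⟨ cong₂ _+_ (+-interchange i₁ b₁ i₂ b₂) count-∷ ⟩
  ((i₁ + i₂) + (b₁ + b₂)) + (i₃ + count s (detached L U P))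
    ≡⟨ +-interchange (i₁ + i₂) (b₁ + b₂) i₃ (count s (detached L U P)) ⟩
  ((i₁ + i₂) + i₃) + ((b₁ + b₂) + count s (detached L U P))
    ≡⟨ cong₂ _+_ (between-column s l≤p p≤u) (between-detached s L≼P P≼U) ⟩
  between s (l ∷ L) (u ∷ U) ∎
  where
  open ≡-Reasoning
  i₁ = 𝟙 ((l <ᵇ s) ∧ (s <ᵇ p))
  i₂ = 𝟙 ((p <ᵇ s) ∧ (s <ᵇ u))
  i₃ = if l ≡ᵇ p then 0 else if p ≡ᵇ u then 0 else 𝟙 (p ≡ᵇ s)
  b₁ = between s L P
  b₂ = between s P U
  count-∷ : count s (detached (l ∷ L) (u ∷ U) (p ∷ P)) ≡ i₃ + count s (detached L U P)
  count-∷ with l ≡ᵇ p | p ≡ᵇ u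
  ... | true  | _     = ≡-refl
  ... | false | true  = ≡-refl
  ... | false | false = ≡-refl

-- Solved for the gap numbers, the identity shows that for fixed `L` and `U` they depend on `P` only
-- through `detached`, which `stat` and `stat′` share.
between-split : ∀ {x} s {L P U : Vec ℕ x} → L ≼ P → P ≼ U →
                between s L P + between s P U ≡ between s L U ∸ count s (detached L U P)
between-split s {L} {P} {U} L≼P P≼U =
  ≡-trans (≡-sym (m+n∸n≡m _ (count s (detached L U P))))
          (cong (_∸ count s (detached L U P)) (between-detached s L≼P P≼U))

infixr 5 _◂_

_◂_ : ∀ {n} → ℕ → (Fin n → ℕ) → Fin (suc n) → ℕ
(m ◂ h) zero    = m
(m ◂ h) (suc i) = h i

lift : ∀ {m n} → (Fin m → Fin n) → Fin (suc m) → Fin (suc n)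
lift f zero    = zero
lift f (suc i) = suc (f i)

swap₀₁ : ∀ {n} → Fin (suc (suc n)) → Fin (suc (suc n))
swap₀₁ zero          = suc zero
swap₀₁ (suc zero)    = zero
swap₀₁ (suc (suc i)) = suc (suc i)

-- Sums over chains of paths

module Sums {c ℓ : Level} (R : CommutativeSemiring c ℓ) where
  private
    module R = CommutativeSemiring R
  open R using (Carrier; _≈_; 0#)
  open Algebra.Properties.CommutativeSemigroup R.+-commutativeSemigroup using (interchange)
  open import Relation.Binary.Reasoning.Setoid R.setoid

  -- Replaces filtering by zero summands, so that nested sums run over fixed lists and can be
  -- interchanged.
  guard : Bool → Carrier → Carrier
  guard c r = if c then r else 0#

  guard-cong : ∀ c {r r′} → (c ≡ true → r ≈ r′) → guard c r ≈ guard c r′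
  guard-cong true  r≈r′ = r≈r′ ≡-refl
  guard-cong false r≈r′ = R.refl

  guard-∧ : ∀ c d {r} → guard (c ∧ d) r ≡ guard c (guard d r)
  guard-∧ true  d = ≡-refl
  guard-∧ false d = ≡-refl

  module _ {A : Set} where

    ∑-cong-All : ∀ {f g : A → Carrier} {as} → All (λ a → f a ≈ g a) as → ∑ R as f ≈ ∑ R as g
    ∑-cong-All []       = R.refl
    ∑-cong-All (p ∷ ps) = R.+-cong p (∑-cong-All ps)

    ∑-cong : ∀ {f g : A → Carrier} as → (∀ a → f a ≈ g a) → ∑ R as f ≈ ∑ R as g
    ∑-cong as f≈g = ∑-cong-All (All.universal f≈g as)

    ∑-0 : ∀ (as : List A) → ∑ R as (λ _ → 0#) ≈ 0#
    ∑-0 []       = R.refl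
    ∑-0 (a ∷ as) = R.trans (R.+-identityˡ _) (∑-0 as)

    ∑-guard : ∀ c (as : List A) {f} → ∑ R as (λ a → guard c (f a)) ≈ guard c (∑ R as f)
    ∑-guard true  as = R.refl
    ∑-guard false as = ∑-0 as

    ∑-filter : ∀ (p : A → Bool) as {f} → ∑ R (filterᵇ p as) f ≈ ∑ R as (λ a → guard (p a) (f a))
    ∑-filter p []       = R.refl
    ∑-filter p (a ∷ as) with p a
    ... | true  = R.+-congˡ (∑-filter p as)
    ... | false = R.trans (∑-filter p as) (R.sym (R.+-identityˡ _))

    ∑-++ : ∀ (as bs : List A) {f} → ∑ R (as ++ bs) f ≈ ∑ R as f R.+ ∑ R bs f
    ∑-++ []       bs = R.sym (R.+-identityˡ _)
    ∑-++ (a ∷ as) bs = R.trans (R.+-congˡ (∑-++ as bs)) (R.sym (R.+-assoc _ _ _))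

    ∑-+ : ∀ (as : List A) {f g} → ∑ R as (λ a → f a R.+ g a) ≈ ∑ R as f R.+ ∑ R as g
    ∑-+ []       = R.sym (R.+-identityˡ _)
    ∑-+ (a ∷ as) = R.trans (R.+-congˡ (∑-+ as)) (interchange _ _ _ _)

    ∑-↭ : ∀ {as bs : List A} {f} → as ↭ bs → ∑ R as f ≈ ∑ R bs f
    ∑-↭ refl          = R.refl
    ∑-↭ (prep a p)    = R.+-congˡ (∑-↭ p)
    ∑-↭ (swap a b p) = R.trans (R.sym (R.+-assoc _ _ _))
      (R.trans (R.+-cong (R.+-comm _ _) (∑-↭ p)) (R.+-assoc _ _ _))
    ∑-↭ (trans p q)   = R.trans (∑-↭ p) (∑-↭ q)

  ∑-map : ∀ {A B : Set} (g : A → B) as {f} → ∑ R (map g as) f ≡ ∑ R as (f ∘ g)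
  ∑-map g []       = ≡-refl
  ∑-map g (a ∷ as) = cong (_ R.+_) (∑-map g as)

  ∑-concatMap : ∀ {A B : Set} (g : A → List B) as {f} →
                ∑ R (concatMap g as) f ≈ ∑ R as (λ a → ∑ R (g a) f)
  ∑-concatMap g []       = R.refl
  ∑-concatMap g (a ∷ as) = R.trans (∑-++ (g a) _) (R.+-congˡ (∑-concatMap g as))

  ∑-comm : ∀ {A B : Set} (as : List A) (bs : List B) {f : A → B → Carrier} →
           ∑ R as (λ a → ∑ R bs (f a)) ≈ ∑ R bs (λ b → ∑ R as (λ a → f a b))
  ∑-comm []       bs = R.sym (∑-0 bs)
  ∑-comm (a ∷ as) bs = R.trans (R.+-congˡ (∑-comm as bs)) (R.sym (∑-+ bs))

-- Permuting the contact numbers of a chain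

module Chains {c ℓ : Level} (R : CommutativeSemiring c ℓ) {x : ℕ} (y : ℕ)
              (B : Vec ℕ x) (decB : Decreasing y B) where
  open CommutativeSemiring R using (Carrier; _≈_; 0#; setoid) renaming (refl to ≈-refl; sym to ≈-sym; trans to ≈-trans)
  open Sums R
  open import Relation.Binary.Reasoning.Setoid setoid

  infixl 6 _⊕_

  _⊕_ : (ℕ → ℕ) → (ℕ → ℕ) → ℕ → ℕ
  (u ⊕ u′) s = u s + u′ s

  gaps : Vec ℕ x → Vec ℕ x → ℕ → ℕ
  gaps D D′ s = between s D D′

  -- Arbitrary functions of the contact numbers and of 𝐮 are allowed, not only monomials: splitting
  -- off the top path then yields another weight, `cons T P Φ`.
  Weight : ℕ → Set c
  Weight k = (Fin (suc k) → ℕ) → (ℕ → ℕ) → Carrier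

  Extensional : ∀ {k} → Weight k → Set ℓ
  Extensional Φ = ∀ {h h′ u u′} → h ≗ h′ → u ≗ u′ → Φ h u ≈ Φ h′ u′

  cons : ∀ {k} → Vec ℕ x → Vec ℕ x → Weight (suc k) → Weight k
  cons T P Φ h u = Φ (contacts T P ◂ h) (gaps T P ⊕ u)

  ◂-cong : ∀ {n m} {h h′ : Fin n → ℕ} → h ≗ h′ → m ◂ h ≗ m ◂ h′
  ◂-cong h≗ zero    = ≡-refl
  ◂-cong h≗ (suc i) = h≗ i

  cons-ext : ∀ {k} T P {Φ : Weight (suc k)} → Extensional Φ → Extensional (cons T P Φ)
  cons-ext T P ext h≗ u≗ = ext (◂-cong h≗) (λ s → cong (between s T P +_) (u≗ s))

  chainSum : ∀ k → Vec ℕ x → Weight k → Carrier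
  chainSum zero    T Φ = guard (T ≼ᵇ B) (Φ (λ _ → contacts T B) (gaps T B))
  chainSum (suc k) T Φ = ∑ R (seqs x y) (λ P → guard (T ≼ᵇ P) (chainSum k P (cons T P Φ)))

  chainSum-cong : ∀ k T {Φ Ψ : Weight k} → (∀ h u → Φ h u ≈ Ψ h u) → chainSum k T Φ ≈ chainSum k T Ψ
  chainSum-cong zero    T Φ≈Ψ = guard-cong (T ≼ᵇ B) (λ _ → Φ≈Ψ _ _)
  chainSum-cong (suc k) T Φ≈Ψ =
    ∑-cong (seqs x y) (λ P → guard-cong (T ≼ᵇ P) (λ _ → chainSum-cong k P (λ h u → Φ≈Ψ _ _)))

  permute : ∀ {k} → (Fin (suc k) → Fin (suc k)) → Weight k → Weight k
  permute f Φ h u = Φ (h ∘ f) u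

  permute-ext : ∀ {k} f {Φ : Weight k} → Extensional Φ → Extensional (permute f Φ)
  permute-ext f ext h≗ u≗ = ext (h≗ ∘ f) u≗

  -- All tops and weights are quantified over because the induction replaces `T` by the first path
  -- `P` and `Φ` by `cons T P Φ`.
  Symmetric : ∀ {k} → (Fin (suc k) → Fin (suc k)) → Set _
  Symmetric {k} f = ∀ T (Φ : Weight k) → Decreasing y T → Extensional Φ → chainSum k T Φ ≈ chainSum k T (permute f Φ)

  Symmetric-resp : ∀ {k} {f g : Fin (suc k) → Fin (suc k)} → f ≗ g → Symmetric f → Symmetric g
  Symmetric-resp {k} f≗g symf T Φ decT ext =
    ≈-trans (symf T Φ decT ext) (chainSum-cong k T (λ h u → ext (λ i → cong h (f≗g i)) (λ _ → ≡-refl)))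

  Symmetric-id : ∀ {k} → Symmetric {k} id
  Symmetric-id T Φ decT ext = ≈-refl

  Symmetric-∘ : ∀ {k} {f g : Fin (suc k) → Fin (suc k)} → Symmetric f → Symmetric g → Symmetric (f ∘ g)
  Symmetric-∘ {g = g} symf symg T Φ decT ext =
    ≈-trans (symg T Φ decT ext) (symf T (permute g Φ) decT (permute-ext g ext))

  -- A permutation fixing 0 concerns only the chain below the first path `P`, which serves as the
  -- new top.
  Symmetric-lift : ∀ {k} {f : Fin (suc k) → Fin (suc k)} → Symmetric f → Symmetric (lift f)
  Symmetric-lift {k} {f} symf T Φ decT ext = ∑-cong-All (All.map under (seqs-decreasing x y))
    where
    lift-◂ : ∀ m h → (m ◂ h) ∘ lift f ≗ m ◂ (h ∘ f)
    lift-◂ m h zero    = ≡-refl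
    lift-◂ m h (suc i) = ≡-refl
    under : ∀ {P} → Decreasing y P →
            guard (T ≼ᵇ P) (chainSum k P (cons T P Φ)) ≈
            guard (T ≼ᵇ P) (chainSum k P (cons T P (permute (lift f) Φ)))
    under {P} decP = guard-cong (T ≼ᵇ P) (λ _ → ≈-trans
      (symf P (cons T P Φ) decP (cons-ext T P ext))
      (chainSum-cong k P (λ h u → ext (λ i → ≡-sym (lift-◂ (contacts T P) h i)) (λ _ → ≡-refl))))

  -- The exchange for one path between fixed neighbours. The gap numbers are a function of `stat`,
  -- and `stats-exchange` swaps the contact numbers while keeping the detached depths.
  middle : ∀ {T Q : Vec ℕ x} → Decreasing y T → Decreasing y Q →
           (ψ : ℕ → ℕ → (ℕ → ℕ) → Carrier) →
           (∀ i j {u u′} → u ≗ u′ → ψ i j u ≈ ψ i j u′) →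
           ∑ R (seqs x y) (λ P → guard (inside T Q P) (ψ (contacts T P) (contacts P Q) (gaps T P ⊕ gaps P Q))) ≈
           ∑ R (seqs x y) (λ P → guard (inside T Q P) (ψ (contacts P Q) (contacts T P) (gaps T P ⊕ gaps P Q)))
  middle {T} {Q} decT decQ ψ ψ-ext with T ≼? Q
  -- Without `T ≼ Q` no `P` lies between them, so every guard is false.
  ... | no T⋠Q = ∑-cong (seqs x y) (λ P → guard-cong (inside T Q P) (λ e → contradiction (squeeze P e) T⋠Q))
    where
    squeeze : ∀ P → inside T Q P ≡ true → T ≼ Q
    squeeze P e with T ≼? P | P ≼? Q
    ... | yes T≼P | yes P≼Q = Pointwise.trans ≤-trans T≼P P≼Q
  ... | yes T≼Q = begin
    ∑ R (seqs x y) (λ P → guard (inside T Q P) (ψ (contacts T P) (contacts P Q) (gaps T P ⊕ gaps P Q)))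
      ≈⟨ ∑-cong (seqs x y) (λ P → guard-cong (inside T Q P) (λ e → ψ-ext _ _ (split P e))) ⟩
    ∑ R (seqs x y) (λ P → guard (inside T Q P) (ψ̂ (stat T Q P)))
      ≈⟨ ∑-filter (inside T Q) (seqs x y) ⟨
    ∑ R Ps (ψ̂ ∘ stat T Q)            ≡⟨ ∑-map (stat T Q) Ps ⟨
    ∑ R (map (stat T Q) Ps) ψ̂        ≈⟨ ∑-↭ (stats-exchange decT decQ T≼Q) ⟩
    ∑ R (map (stat′ T Q) Ps) ψ̂       ≡⟨ ∑-map (stat′ T Q) Ps ⟩
    ∑ R Ps (ψ̂ ∘ stat′ T Q)           ≈⟨ ∑-filter (inside T Q) (seqs x y) ⟩
    ∑ R (seqs x y) (λ P → guard (inside T Q P) (ψ̂ (stat′ T Q P)))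
      ≈⟨ ∑-cong (seqs x y) (λ P → guard-cong (inside T Q P) (λ e → ψ-ext _ _ (λ s → split P e s))) ⟨
    ∑ R (seqs x y) (λ P → guard (inside T Q P) (ψ (contacts P Q) (contacts T P) (gaps T P ⊕ gaps P Q))) ∎
    where
    Ps = filterᵇ (inside T Q) (seqs x y)
    ψ̂ : Stat → Carrier
    ψ̂ (i , j , w) = ψ i j (λ s → between s T Q ∸ count s w)
    split : ∀ P → inside T Q P ≡ true → gaps T P ⊕ gaps P Q ≗ λ s → between s T Q ∸ count s (detached T Q P)
    split P e s with T ≼? P | P ≼? Q
    ... | yes T≼P | yes P≼Q = between-split s T≼P P≼Q

  -- Only the first path varies, between `T` and its lower neighbour, which is `B` for a single path
  -- and otherwise the second path `Q`.
  Symmetric-swap₀₁ : ∀ {k} → Symmetric {suc k} swap₀₁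
  Symmetric-swap₀₁ {zero} T Φ decT ext = begin
    chainSum 1 T Φ
      ≈⟨ ∑-cong (seqs x y) (λ P → ≈-trans (guard-cong (T ≼ᵇ P) (λ _ → guard-cong (P ≼ᵇ B) (λ _ → ext (λ _ → ≡-refl) (λ _ → ≡-refl))))
                                          (≈-sym (merge P))) ⟩
    ∑ R (seqs x y) (λ P → guard (inside T B P) (ψ (contacts T P) (contacts P B) (gaps T P ⊕ gaps P B)))
      ≈⟨ middle decT decB ψ (λ i j u≗ → ext (λ _ → ≡-refl) u≗) ⟩
    ∑ R (seqs x y) (λ P → guard (inside T B P) (ψ (contacts P B) (contacts T P) (gaps T P ⊕ gaps P B)))
      ≈⟨ ∑-cong (seqs x y) (λ P → ≈-trans (merge P)
           (guard-cong (T ≼ᵇ P) (λ _ → guard-cong (P ≼ᵇ B) (λ _ → ext (swapped P) (λ _ → ≡-refl))))) ⟩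
    chainSum 1 T (permute swap₀₁ Φ) ∎
    where
    ψ : ℕ → ℕ → (ℕ → ℕ) → Carrier
    ψ i j = Φ (i ◂ λ _ → j)
    merge : ∀ P {r} → guard (inside T B P) r ≈ guard (T ≼ᵇ P) (guard (P ≼ᵇ B) r)
    merge P = CommutativeSemiring.reflexive R (guard-∧ (T ≼ᵇ P) (P ≼ᵇ B))
    swapped : ∀ P → contacts P B ◂ (λ _ → contacts T P) ≗ (contacts T P ◂ (λ _ → contacts P B)) ∘ swap₀₁
    swapped P zero       = ≡-refl
    swapped P (suc zero) = ≡-refl
  Symmetric-swap₀₁ {suc k} T Φ decT ext = begin
    chainSum (suc (suc k)) T Φ
      ≈⟨ pull Φ (λ P Q → chainSum k Q (ψ (contacts T P) (contacts P Q) (gaps T P ⊕ gaps P Q)))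
              (λ P Q → chainSum-cong k Q (λ h u → ext (λ _ → ≡-refl) (λ s → ≡-sym (+-assoc (gaps T P s) (gaps P Q s) (u s))))) ⟩
    ∑ R (seqs x y) (λ Q → ∑ R (seqs x y) (λ P → guard (inside T Q P)
      (chainSum k Q (ψ (contacts T P) (contacts P Q) (gaps T P ⊕ gaps P Q)))))
      ≈⟨ ∑-cong-All (All.map (λ {Q} decQ → middle decT decQ (λ i j u → chainSum k Q (ψ i j u))
           (λ i j u≗ → chainSum-cong k Q (λ h u → ext (λ _ → ≡-refl) (λ s → cong (_+ u s) (u≗ s)))))
           (seqs-decreasing x y)) ⟩
    ∑ R (seqs x y) (λ Q → ∑ R (seqs x y) (λ P → guard (inside T Q P)
      (chainSum k Q (ψ (contacts P Q) (contacts T P) (gaps T P ⊕ gaps P Q)))))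
      ≈⟨ pull (permute swap₀₁ Φ) (λ P Q → chainSum k Q (ψ (contacts P Q) (contacts T P) (gaps T P ⊕ gaps P Q)))
              (λ P Q → chainSum-cong k Q (λ h u → ext (swapped (contacts T P) (contacts P Q) h)
                                               (λ s → ≡-sym (+-assoc (gaps T P s) (gaps P Q s) (u s))))) ⟨
    chainSum (suc (suc k)) T (permute swap₀₁ Φ) ∎
    where
    -- Here `u` collects the gaps on both sides of `P`, and `u′` those further down.
    ψ : ℕ → ℕ → (ℕ → ℕ) → Weight k
    ψ i j u h u′ = Φ (i ◂ j ◂ h) (u ⊕ u′)
    swapped : ∀ i j h → (i ◂ j ◂ h) ∘ swap₀₁ ≗ j ◂ i ◂ h
    swapped i j h zero          = ≡-refl
    swapped i j h (suc zero)    = ≡-refl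
    swapped i j h (suc (suc m)) = ≡-refl
    -- Moves the sum over the second path outside, so that `middle` applies to the inner sum for
    -- fixed `Q`.
    pull : ∀ Φ (r : Vec ℕ x → Vec ℕ x → Carrier) → (∀ P Q → chainSum k Q (cons P Q (cons T P Φ)) ≈ r P Q) →
           chainSum (suc (suc k)) T Φ ≈ ∑ R (seqs x y) (λ Q → ∑ R (seqs x y) (λ P → guard (inside T Q P) (r P Q)))
    pull Φ r eq = begin
      ∑ R (seqs x y) (λ P → guard (T ≼ᵇ P) (∑ R (seqs x y) (λ Q → guard (P ≼ᵇ Q) (chainSum k Q (cons P Q (cons T P Φ))))))
        ≈⟨ ∑-cong (seqs x y) (λ P → ∑-guard (T ≼ᵇ P) (seqs x y)) ⟨
      ∑ R (seqs x y) (λ P → ∑ R (seqs x y) (λ Q → guard (T ≼ᵇ P) (guard (P ≼ᵇ Q) (chainSum k Q (cons P Q (cons T P Φ))))))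
        ≈⟨ ∑-comm (seqs x y) (seqs x y) ⟩
      ∑ R (seqs x y) (λ Q → ∑ R (seqs x y) (λ P → guard (T ≼ᵇ P) (guard (P ≼ᵇ Q) (chainSum k Q (cons P Q (cons T P Φ))))))
        ≈⟨ ∑-cong (seqs x y) (λ Q → ∑-cong (seqs x y) (λ P → ≈-trans
             (CommutativeSemiring.reflexive R (≡-sym (guard-∧ (T ≼ᵇ P) (P ≼ᵇ Q))))
             (guard-cong (inside T Q P) (λ _ → eq P Q)))) ⟩
      ∑ R (seqs x y) (λ Q → ∑ R (seqs x y) (λ P → guard (inside T Q P) (r P Q))) ∎

  -- Induction on `j` by conjugation: (0 j+1) = (0 1)(1 j+1)(0 1), where (1 j+1) is the lift of (0
  -- j).
  Symmetric-transpose₀ : ∀ {k} (j : Fin (suc k)) → Symmetric (PC.transpose zero j)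
  Symmetric-transpose₀ zero = Symmetric-resp same Symmetric-id
    where
    same : ∀ {n} → id ≗ PC.transpose {suc n} zero zero
    same zero    = ≡-refl
    same (suc i) = ≡-refl
  Symmetric-transpose₀ {suc k} (suc zero) = Symmetric-resp same Symmetric-swap₀₁
    where
    same : ∀ {n} → swap₀₁ ≗ PC.transpose {suc (suc n)} zero (suc zero)
    same zero          = ≡-refl
    same (suc zero)    = ≡-refl
    same (suc (suc i)) = ≡-refl
  Symmetric-transpose₀ {suc k} (suc j@(suc j′)) =
    Symmetric-resp same
      (Symmetric-∘ {f = swap₀₁} {g = shifted ∘ swap₀₁} Symmetric-swap₀₁
        (Symmetric-∘ {f = shifted} {g = swap₀₁} (Symmetric-lift (Symmetric-transpose₀ j)) Symmetric-swap₀₁))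
    where
    shifted : Fin (suc (suc k)) → Fin (suc (suc k))
    shifted = lift (PC.transpose zero j)
    same : swap₀₁ ∘ shifted ∘ swap₀₁ ≗ PC.transpose zero (suc j)
    same zero       = ≡-refl
    same (suc zero) = ≡-refl
    same (suc (suc i)) with does (i Fin.≟ j′)
    ... | true  = ≡-refl
    ... | false = ≡-refl

  Symmetric-transpose : ∀ {k} (i j : Fin (suc k)) → Symmetric (PC.transpose i j)
  Symmetric-transpose zero    j    = Symmetric-transpose₀ j
  Symmetric-transpose (suc i) zero = Symmetric-resp same (Symmetric-transpose₀ (suc i))
    where
    same : PC.transpose zero (suc i) ≗ PC.transpose (suc i) zero
    same zero    = ≡-refl
    same (suc m) with does (m Fin.≟ i)
    ... | true  = ≡-refl
    ... | false = ≡-refl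
  Symmetric-transpose {suc k} (suc i) (suc j) =
    Symmetric-resp same (Symmetric-lift (Symmetric-transpose i j))
    where
    same : lift (PC.transpose i j) ≗ PC.transpose (suc i) (suc j)
    same zero    = ≡-refl
    same (suc m) = ≡-sym (lift₀-transpose i j (suc m))

  Symmetric-permutation : ∀ {k} (π : Permutation′ (suc k)) → Symmetric (π ⟨$⟩ʳ_)
  Symmetric-permutation {k} π = Symmetric-resp (eval-decompose π) (evaluated (decompose π))
    where
    evaluated : (τs : TranspositionList (suc k)) → Symmetric (eval τs ⟨$⟩ʳ_)
    evaluated []             = Symmetric-id
    -- `eval` applies the head transposition first, so it is the inner factor.
    evaluated ((i , j) ∷ τs) = Symmetric-∘ (evaluated τs) (Symmetric-transpose i j)

-- From lattice paths to depth sequences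

-- Junk if the path has fewer than x east steps.
depths : ∀ x → ℕ → Path → Vec ℕ x
depths zero    y P       = []
depths (suc x) y []      = y ∷ depths x y []
depths (suc x) y (E ∷ P) = y ∷ depths x y P
depths (suc x) y (N ∷ P) = depths (suc x) (pred y) P

depths-decreasing : ∀ x y P → Decreasing y (depths x y P)
depths-decreasing zero    y P       = []
depths-decreasing (suc x) y []      = ≤-refl ∷ depths-decreasing x y []
depths-decreasing (suc x) y (E ∷ P) = ≤-refl ∷ depths-decreasing x y P
depths-decreasing (suc x) y (N ∷ P) = Decreasing-weaken pred[n]≤n (depths-decreasing (suc x) (pred y) P)

-- `E` becomes an entry and `N` lowers the bound, so `seqs` copies the recursion of `paths`, order
-- included.
map-depths-paths : ∀ x y → map (depths x y) (paths x y) ≡ seqs x y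
map-depths-paths zero zero = ≡-refl
map-depths-paths zero (suc y) = ≡-trans (≡-sym (map-∘ (paths zero y))) (map-depths-paths zero y)
map-depths-paths (suc x) zero = begin
  map (depths (suc x) 0) (map (E ∷_) (paths x 0)) ≡⟨ map-∘ (paths x 0) ⟨
  map (λ P → 0 ∷ depths x 0 P) (paths x 0)        ≡⟨ map-∘ (paths x 0) ⟩
  map (0 ∷_) (map (depths x 0) (paths x 0))       ≡⟨ cong (map (0 ∷_)) (map-depths-paths x 0) ⟩
  map (0 ∷_) (seqs x 0)                           ∎
  where open ≡-Reasoning
map-depths-paths (suc x) (suc y) = begin
  map D (map (E ∷_) Ps ++ map (N ∷_) Qs)         ≡⟨ map-++ D (map (E ∷_) Ps) _ ⟩
  map D (map (E ∷_) Ps) ++ map D (map (N ∷_) Qs) ≡⟨ cong₂ _++_ (map-∘ Ps) (map-∘ Qs) ⟨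
  map (λ P → suc y ∷ depths x (suc y) P) Ps ++ map (depths (suc x) y) Qs
    ≡⟨ cong₂ _++_ (≡-trans (map-∘ Ps) (cong (map (suc y ∷_)) (map-depths-paths x (suc y))))
                  (map-depths-paths (suc x) y) ⟩
  seqs (suc x) (suc y) ∎
  where
  open ≡-Reasoning
  D  = depths (suc x) (suc y)
  Ps = paths x (suc y)
  Qs = paths (suc x) y

paths-endAt : ∀ x y → All (EndsAt x y) (paths x y)
paths-endAt zero    zero    = (≡-refl , ≡-refl) ∷ []
paths-endAt zero    (suc y) = All.map⁺ (All.map (λ (p , q) → p , cong suc q) (paths-endAt zero y))
paths-endAt (suc x) zero    = All.map⁺ (All.map (λ (p , q) → cong suc p , q) (paths-endAt x zero))
paths-endAt (suc x) (suc y) =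
  All.++⁺ (All.map⁺ (All.map (λ (p , q) → cong suc p , q) (paths-endAt x (suc y))))
          (All.map⁺ (All.map (λ (p , q) → p , cong suc q) (paths-endAt (suc x) y)))

enum : ∀ {x} → ℕ → ℕ → Vec ℕ x → List EastStep
enum y a []      = []
enum y a (d ∷ D) = (a , y ∸ d) ∷ enum y (suc a) D

-- Invariant: `c` is the height already reached and `d` the number of north steps left.
eastStepsFrom≡enum : ∀ {x d y} a c P → EndsAt x d P → c + d ≡ y →
                     eastStepsFrom a c P ≡ enum y a (depths x d P)
eastStepsFrom≡enum a c [] (≡-refl , ≡-refl) c+d≡y = ≡-refl
eastStepsFrom≡enum {d = d} a c (E ∷ P) (≡-refl , end) ≡-refl =
  cong₂ _∷_ (cong (a ,_) (≡-sym (m+n∸n≡m c d))) (eastStepsFrom≡enum (suc a) c P (≡-refl , end) ≡-refl)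
eastStepsFrom≡enum {zero}  {suc d} a c (N ∷ P) (p , q) c+d≡y =
  eastStepsFrom≡enum a (suc c) P (p , suc-injective q) (≡-trans (≡-sym (+-suc c d)) c+d≡y)
eastStepsFrom≡enum {suc x} {suc d} a c (N ∷ P) (p , q) c+d≡y =
  eastStepsFrom≡enum a (suc c) P (p , suc-injective q) (≡-trans (≡-sym (+-suc c d)) c+d≡y)

eastSteps≡enum : ∀ {x y P} → EndsAt x y P → eastSteps P ≡ enum y 0 (depths x y P)
eastSteps≡enum {P = P} end = eastStepsFrom≡enum 0 0 P end ≡-refl

-- The default 0 makes `nth-decreasing` and `nth-≼` hold at every index.
nth : ∀ {n} → Vec ℕ n → ℕ → ℕ
nth []      i       = 0
nth (d ∷ D) zero    = d
nth (d ∷ D) (suc i) = nth D i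

nth-decreasing : ∀ {n y} {D : Vec ℕ n} → Decreasing y D → ∀ i → nth D i ≤ y
nth-decreasing []           i       = z≤n
nth-decreasing (d≤y ∷ decD) zero    = d≤y
nth-decreasing (d≤y ∷ decD) (suc i) = ≤-trans (nth-decreasing decD i) d≤y

nth-≼ : ∀ {n} {D D′ : Vec ℕ n} → D ≼ D′ → ∀ i → nth D i ≤ nth D′ i
nth-≼ []          i       = z≤n
nth-≼ (d≤e ∷ D≼E) zero    = d≤e
nth-≼ (d≤e ∷ D≼E) (suc i) = nth-≼ D≼E i

-- There is one east step in each column, so a test that is neutral off one column reduces to the
-- step there. The operation is abstract to serve both `all` and `any`.
fold-column : (_∙_ : Bool → Bool → Bool) {e : Bool} → (∀ c → e ∙ c ≡ c) → (∀ c → c ∙ e ≡ c) →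
              ∀ {n y} (D : Vec ℕ n) a i (t : EastStep → Bool) →
              i < n → (∀ a′ c → a′ ≢ a + i → t (a′ , c) ≡ e) →
              foldr _∙_ e (map t (enum y a D)) ≡ t (a + i , y ∸ nth D i)
fold-column _∙_ {e} idˡ idʳ {y = y} (d ∷ D) a zero t i<n off
  rewrite +-identityʳ a = ≡-trans (cong (t (a , y ∸ d) ∙_) (beyond D (suc a) (n<1+n a))) (idʳ _)
  where
  beyond : ∀ {n} (D : Vec ℕ n) b → a < b → foldr _∙_ e (map t (enum y b D)) ≡ e
  beyond []      b a<b = ≡-refl
  beyond (d ∷ D) b a<b =
    ≡-trans (cong₂ _∙_ (off b _ (≢-sym (<⇒≢ a<b))) (beyond D (suc b) (m<n⇒m<1+n a<b))) (idˡ e)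
fold-column _∙_ idˡ idʳ {y = y} (d ∷ D) a (suc i) t (s≤s i<n) off
  rewrite off a (y ∸ d) (<⇒≢ (m<m+n a (s≤s z≤n))) | +-suc a i =
  ≡-trans (idˡ _) (fold-column _∙_ idˡ idʳ D (suc a) i t i<n off)

all-enum : ∀ {n y} (D D′ : Vec ℕ n) a (t : EastStep → Bool) (r : ℕ → ℕ → Bool) →
           (∀ i → i < n → t (a + i , y ∸ nth D i) ≡ r (nth D i) (nth D′ i)) →
           all t (enum y a D) ≡ foldr _∧_ true (toList (Vec.zipWith r D D′))
all-enum []      []       a t r t≡r = ≡-refl
all-enum {y = y} (d ∷ D) (d′ ∷ D′) a t r t≡r =
  cong₂ _∧_ (≡-trans (cong (λ b → t (b , y ∸ d)) (≡-sym (+-identityʳ a))) (t≡r 0 (s≤s z≤n)))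
            (all-enum D D′ (suc a) t r (λ i i<n →
              ≡-trans (cong (λ b → t (b , y ∸ nth D i)) (≡-sym (+-suc a i))) (t≡r (suc i) (s≤s i<n))))

and-zipWith-≤ : ∀ {n} (D D′ : Vec ℕ n) → foldr _∧_ true (toList (Vec.zipWith _≤ᵇ_ D D′)) ≡ D ≼ᵇ D′
and-zipWith-≤ []      []        = ≡-refl
and-zipWith-≤ (d ∷ D) (d′ ∷ D′) = cong ((d ≤ᵇ d′) ∧_) (and-zipWith-≤ D D′)

length-filter-enum : ∀ {n y} (D D′ : Vec ℕ n) a (t : EastStep → Bool) →
                     (∀ i → i < n → t (a + i , y ∸ nth D i) ≡ (nth D i ≡ᵇ nth D′ i)) →
                     length (filterᵇ t (enum y a D)) ≡ contacts D D′
length-filter-enum []      []       a t t≡ = ≡-refl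
length-filter-enum {y = y} (d ∷ D) (d′ ∷ D′) a t t≡
  with ih ← length-filter-enum D D′ (suc a) t (λ i i<n →
              ≡-trans (cong (λ b → t (b , y ∸ nth D i)) (≡-sym (+-suc a i))) (t≡ (suc i) (s≤s i<n)))
     | eq ← ≡-trans (cong (λ b → t (b , y ∸ d)) (≡-sym (+-identityʳ a))) (t≡ 0 (s≤s z≤n))
  rewrite eq with d ≡ᵇ d′
... | true  = cong suc ih
... | false = ih

-- Passing between heights and depths reverses the order; the bounds by `y` keep truncated
-- subtraction injective.
∸-≤ᵇ : ∀ {y d e} → d ≤ y → e ≤ y → ((y ∸ e) ≤ᵇ (y ∸ d)) ≡ (d ≤ᵇ e)
∸-≤ᵇ {y} {d} {e} d≤y e≤y = does-⇔ (mk⇔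
  (λ le → ≮⇒≥ (λ e<d → <⇒≱ (∸-monoʳ-< e<d d≤y) le))
  (∸-monoʳ-≤ y)) ((y ∸ e) ≤? (y ∸ d)) (d ≤? e)

∸-<ᵇ : ∀ {y d e} → d ≤ y → e ≤ y → ((y ∸ e) <ᵇ (y ∸ d)) ≡ (d <ᵇ e)
∸-<ᵇ {y} {d} {e} d≤y e≤y = does-⇔ (mk⇔
  (λ lt → ≰⇒> (λ e≤d → <⇒≱ lt (∸-monoʳ-≤ y e≤d)))
  (λ d<e → ∸-monoʳ-< d<e e≤y)) ((y ∸ e) <? (y ∸ d)) (d <? e)

∸-≡ᵇ : ∀ {y d e} → d ≤ y → e ≤ y → ((y ∸ d) ≡ᵇ (y ∸ e)) ≡ (d ≡ᵇ e)
∸-≡ᵇ {y} {d} {e} d≤y e≤y =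
  does-⇔ (mk⇔ (∸-cancelˡ-≡ d≤y e≤y) (cong (y ∸_))) ((y ∸ d) ≟ (y ∸ e)) (d ≟ e)

module _ {x y : ℕ} where
  private
    δ : Path → Vec ℕ x
    δ = depths x y

    δ≤ : ∀ P i → nth (δ P) i ≤ y
    δ≤ P = nth-decreasing (depths-decreasing x y P)

  all-column : ∀ {P} → EndsAt x y P → ∀ a (t : EastStep → Bool) → a < x →
               (∀ a′ c → a′ ≢ a → t (a′ , c) ≡ true) → all t (eastSteps P) ≡ t (a , y ∸ nth (δ P) a)
  all-column {P} end a t a<x off rewrite eastSteps≡enum {x} {y} {P} end =
    fold-column _∧_ ∧-identityˡ ∧-identityʳ (δ P) 0 a t a<x off

  usesᵇ≡ : ∀ {P} → EndsAt x y P → ∀ {a s} → a < x → s ≤ y → usesᵇ P (a , y ∸ s) ≡ (s ≡ᵇ nth (δ P) a)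
  usesᵇ≡ {P} end {a} {s} a<x s≤y rewrite eastSteps≡enum {x} {y} {P} end =
    ≡-trans (fold-column _∨_ ∨-identityˡ ∨-identityʳ (δ P) 0 a _ a<x off) on
    where
    off : ∀ a′ c → a′ ≢ a → ((a , y ∸ s) ==ₑ (a′ , c)) ≡ false
    off a′ c a′≢a rewrite dec-false (a ≟ a′) (≢-sym a′≢a) = ≡-refl
    on : ((a , y ∸ s) ==ₑ (a , y ∸ nth (δ P) a)) ≡ (s ≡ᵇ nth (δ P) a)
    on rewrite dec-true (a ≟ a) ≡-refl = ∸-≡ᵇ s≤y (δ≤ P a)

  strictlyBetweenᵇ≡ : ∀ {T B} → EndsAt x y T → EndsAt x y B → ∀ {a s} → a < x → s ≤ y →
                      strictlyBetweenᵇ T B (a , y ∸ s) ≡ (nth (δ T) a <ᵇ s) ∧ (s <ᵇ nth (δ B) a)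
  strictlyBetweenᵇ≡ {T} {B} endT endB {a} {s} a<x s≤y =
    cong₂ _∧_ (≡-trans (all-column {T} endT a _ a<x off) onT) (≡-trans (all-column {B} endB a _ a<x off) onB)
    where
    off : ∀ {r : ℕ → Bool} a′ c → a′ ≢ a → (not (a ≡ᵇ a′) ∨ r c) ≡ true
    off a′ c a′≢a rewrite dec-false (a ≟ a′) (≢-sym a′≢a) = ≡-refl
    onT : (not (a ≡ᵇ a) ∨ ((y ∸ s) <ᵇ (y ∸ nth (δ T) a))) ≡ (nth (δ T) a <ᵇ s)
    onT rewrite dec-true (a ≟ a) ≡-refl = ∸-<ᵇ (δ≤ T a) s≤y
    onB : (not (a ≡ᵇ a) ∨ ((y ∸ nth (δ B) a) <ᵇ (y ∸ s))) ≡ (s <ᵇ nth (δ B) a)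
    onB rewrite dec-true (a ≟ a) ≡-refl = ∸-<ᵇ s≤y (δ≤ B a)

  weaklyAboveᵇ≡ : ∀ {P Q} → EndsAt x y P → EndsAt x y Q → weaklyAboveᵇ P Q ≡ (δ P ≼ᵇ δ Q)
  weaklyAboveᵇ≡ {P} {Q} endP endQ rewrite eastSteps≡enum {x} {y} {P} endP =
    ≡-trans (all-enum (δ P) (δ Q) 0 _ _≤ᵇ_ (λ a a<x → ≡-trans (all-column {Q} endQ a _ a<x off) (on a)))
            (and-zipWith-≤ (δ P) (δ Q))
    where
    off : ∀ {a} {r : ℕ → Bool} a′ c → a′ ≢ a → (not (a ≡ᵇ a′) ∨ r c) ≡ true
    off {a} a′ c a′≢a rewrite dec-false (a ≟ a′) (≢-sym a′≢a) = ≡-refl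
    on : ∀ a → (not (a ≡ᵇ a) ∨ ((y ∸ nth (δ Q) a) ≤ᵇ (y ∸ nth (δ P) a))) ≡ (nth (δ P) a ≤ᵇ nth (δ Q) a)
    on a rewrite dec-true (a ≟ a) ≡-refl = ∸-≤ᵇ (δ≤ P a) (δ≤ Q a)

  contacts≡ : ∀ {P Q} → EndsAt x y P → EndsAt x y Q →
              length (filterᵇ (usesᵇ Q) (eastSteps P)) ≡ contacts (δ P) (δ Q)
  contacts≡ {P} {Q} endP endQ rewrite eastSteps≡enum {x} {y} {P} endP =
    length-filter-enum (δ P) (δ Q) 0 (usesᵇ Q) (λ a a<x → usesᵇ≡ {Q} endQ a<x (δ≤ P a))

tally : ℕ → (ℕ → Bool) → ℕ
tally zero    f = 0
tally (suc n) f = 𝟙 (f 0) + tally n (f ∘ suc)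

tally-cong : ∀ n {f g} → (∀ {i} → i < n → f i ≡ g i) → tally n f ≡ tally n g
tally-cong zero    f≡g = ≡-refl
tally-cong (suc n) f≡g =
  cong₂ (λ c m → 𝟙 c + m) (f≡g (s≤s z≤n)) (tally-cong n (λ i<n → f≡g (s≤s i<n)))

length-filter-applyUpTo : ∀ f (g : ℕ → ℕ) n → length (filterᵇ f (applyUpTo g n)) ≡ tally n (f ∘ g)
length-filter-applyUpTo f g zero    = ≡-refl
length-filter-applyUpTo f g (suc n) with f (g 0)
... | true  = cong suc (length-filter-applyUpTo f (g ∘ suc) n)
... | false = length-filter-applyUpTo f (g ∘ suc) n

tally-between : ∀ {n} s (D D′ : Vec ℕ n) →
                tally n (λ a → (nth D a <ᵇ s) ∧ (s <ᵇ nth D′ a)) ≡ between s D D′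
tally-between s []      []        = ≡-refl
tally-between s (d ∷ D) (d′ ∷ D′) = cong (_ +_) (tally-between s D D′)

tally-+ : ∀ n {f g h} →
          (∀ i → 𝟙 (f i) ≡ 𝟙 (g i) + 𝟙 (h i)) →
          tally n f ≡ tally n g + tally n h
tally-+ zero    eq = ≡-refl
tally-+ (suc n) {f} {g} {h} eq = ≡-trans (cong₂ _+_ (eq 0) (tally-+ n (eq ∘ suc)))
  (+-interchange (𝟙 (g 0)) (𝟙 (h 0)) _ _)

-- The condition of `uₛ` in one column, read in depths: `t` and `b` belong to the boundaries, `ps`
-- to the paths.
vacant : ℕ → ℕ → ℕ → List ℕ → Bool
vacant s t b ps = ((t <ᵇ s) ∧ (s <ᵇ b)) ∧ not (any (s ≡ᵇ_) ps)

any-≡ᵇ-below : ∀ {s p ps} → s < p → All (p ≤_) ps → any (s ≡ᵇ_) ps ≡ false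
any-≡ᵇ-below s<p []                       = ≡-refl
any-≡ᵇ-below {s} s<p (_∷_ {q} p≤q p≤ps)
  rewrite dec-false (s ≟ q) (<⇒≢ (<-≤-trans s<p p≤q)) = any-≡ᵇ-below s<p p≤ps

vacant-∷ : ∀ s {t p b ps} → t ≤ p → p ≤ b → All (p ≤_) ps →
           𝟙 (vacant s t b (p ∷ ps)) ≡
           𝟙 ((t <ᵇ s) ∧ (s <ᵇ p)) + 𝟙 (vacant s p b ps)
vacant-∷ s {t} {p} {b} {ps} t≤p p≤b p≤ps with <-cmp s p
... | tri< s<p s≢p p≮s
  rewrite dec-true (s <? p) s<p | dec-false (p <? s) p≮s | dec-false (s ≟ p) s≢p
        | dec-true (s <? b) (<-≤-trans s<p p≤b) | any-≡ᵇ-below s<p p≤ps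
  with t <ᵇ s
... | true  = ≡-refl
... | false = ≡-refl
vacant-∷ s {t} {p} {b} {ps} t≤p p≤b p≤ps | tri≈ s≮s ≡-refl _
  rewrite dec-true (s ≟ s) ≡-refl | dec-false (s <? s) s≮s
  with t <ᵇ s | s <ᵇ b
... | true  | true  = ≡-refl
... | true  | false = ≡-refl
... | false | _     = ≡-refl
vacant-∷ s {t} {p} {b} {ps} t≤p p≤b p≤ps | tri> s≮p s≢p p<s
  rewrite dec-false (s <? p) s≮p | dec-true (p <? s) p<s | dec-false (s ≟ p) s≢p
        | dec-true (t <? s) (≤-<-trans t≤p p<s) = ≡-refl

column : ∀ {k x} → Vec (Vec ℕ x) k → ℕ → List ℕ
column []       a = []
column (P ∷ Ps) a = nth P a ∷ column Ps a

column-≥ : ∀ {k x T} {Ps : Vec (Vec ℕ x) k} a → VAll (T ≼_) Ps → All (nth T a ≤_) (column Ps a)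
column-≥ a []         = []
column-≥ a (T≼P ∷ ps) = nth-≼ T≼P a ∷ column-≥ a ps

module _ {x : ℕ} (B : Vec ℕ x) where

  data Chain : ∀ {k} → Vec ℕ x → Vec (Vec ℕ x) k → Set where
    end : ∀ {T} → T ≼ B → Chain T []
    _∷_ : ∀ {k T P} {Ps : Vec (Vec ℕ x) k} → T ≼ P → Chain P Ps → Chain T (P ∷ Ps)

  -- Built with `_×-dec_` so that its Boolean is the conjunction of the guards in `chainSum`.
  chain? : ∀ {k} T (Ps : Vec (Vec ℕ x) k) → Dec (Chain T Ps)
  chain? T []       = map′ end (λ { (end T≼B) → T≼B }) (T ≼? B)
  chain? T (P ∷ Ps) =
    map′ (λ (T≼P , chain) → T≼P ∷ chain) (λ { (T≼P ∷ chain) → T≼P , chain }) (T ≼? P ×-dec chain? P Ps)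

  chain-≼B : ∀ {k T} {Ps : Vec (Vec ℕ x) k} → Chain T Ps → T ≼ B
  chain-≼B (end T≼B)     = T≼B
  chain-≼B (T≼P ∷ chain) = Pointwise.trans ≤-trans T≼P (chain-≼B chain)

  chain-top : ∀ {k T} {Ps : Vec (Vec ℕ x) k} → Chain T Ps → VAll (T ≼_) Ps
  chain-top (end T≼B)     = []
  chain-top (T≼P ∷ chain) = T≼P ∷ VAll.map (Pointwise.trans ≤-trans T≼P) (chain-top chain)

  chain-bottom : ∀ {k T} {Ps : Vec (Vec ℕ x) k} → Chain T Ps → VAll (_≼ B) Ps
  chain-bottom (end T≼B)     = []
  chain-bottom (T≼P ∷ chain) = chain-≼B chain ∷ chain-bottom chain

  chain-contacts : ∀ {k} → Vec ℕ x → Vec (Vec ℕ x) k → Fin (suc k) → ℕ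
  chain-contacts T []       = λ _ → contacts T B
  chain-contacts T (P ∷ Ps) = contacts T P ◂ chain-contacts P Ps

  chain-gaps : ∀ {k} → Vec ℕ x → Vec (Vec ℕ x) k → ℕ → ℕ
  chain-gaps T []       s = between s T B
  chain-gaps T (P ∷ Ps) s = between s T P + chain-gaps P Ps s

  -- Peeling off one path at a time with `vacant-∷` makes 𝐮 additive over consecutive pairs, the
  -- form in which `cons` builds it up.
  tally-vacant : ∀ {k} s T {Ps : Vec (Vec ℕ x) k} → Chain T Ps →
                 tally x (λ a → vacant s (nth T a) (nth B a) (column Ps a)) ≡ chain-gaps T Ps s
  tally-vacant s T (end T≼B) =
    ≡-trans (tally-cong x (λ _ → ∧-identityʳ _)) (tally-between s T B)
  tally-vacant s T (_∷_ {P = P} T≼P chain) = ≡-trans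
    (tally-+ x (λ a → vacant-∷ s (nth-≼ T≼P a) (nth-≼ (chain-≼B chain) a) (column-≥ a (chain-top chain))))
    (cong₂ _+_ (tally-between s T P) (tally-vacant s P chain))

-- The generating function as a sum over chains

tuples-endAt : ∀ x y k → All (VAll (EndsAt x y)) (tuples x y k)
tuples-endAt x y zero    = [] ∷ []
tuples-endAt x y (suc k) = All.concat⁺ (All.map⁺ (All.map
  (λ endP → All.map⁺ (All.map (endP ∷_) (tuples-endAt x y k))) (paths-endAt x y)))

module _ {x y : ℕ} where
  private
    δ : Path → Vec ℕ x
    δ = depths x y

    δs : ∀ {k} → Vec Path k → Vec (Vec ℕ x) k
    δs = Vec.map δ

  h≡chain-contacts : ∀ {k T B} {Ps : Vec Path k} → EndsAt x y T → EndsAt x y B → VAll (EndsAt x y) Ps →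
                     h T B Ps ≗ chain-contacts (δ B) (δ T) (δs Ps)
  h≡chain-contacts {T = T} {B} {[]}     endT endB []            zero    = contacts≡ {P = T} {B} endT endB
  h≡chain-contacts {T = T} {B} {P ∷ Ps} endT endB (endP ∷ ends) zero    = contacts≡ {P = T} {P} endT endP
  h≡chain-contacts {T = T} {B} {P ∷ Ps} endT endB (endP ∷ ends) (suc i) =
    h≡chain-contacts {T = P} {B} endP endB ends i

  any-uses : ∀ {k a s} (Ps : Vec Path k) → VAll (EndsAt x y) Ps → a < x → s ≤ y →
             any (λ P → usesᵇ P (a , y ∸ s)) (toList Ps) ≡ any (s ≡ᵇ_) (column (δs Ps) a)
  any-uses []       []            a<x s≤y = ≡-refl
  any-uses (P ∷ Ps) (endP ∷ ends) a<x s≤y =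
    cong₂ _∨_ (usesᵇ≡ {P = P} endP a<x s≤y) (any-uses Ps ends a<x s≤y)

  uₛ≡chain-gaps : ∀ {k T B s} {Ps : Vec Path k} → EndsAt x y T → EndsAt x y B → VAll (EndsAt x y) Ps →
                  Chain (δ B) (δ T) (δs Ps) → s ≤ y →
                  uₛ x y T B Ps s ≡ chain-gaps (δ B) (δ T) (δs Ps) s
  uₛ≡chain-gaps {T = T} {B} {s} {Ps} endT endB ends chain s≤y = begin
    uₛ x y T B Ps s ≡⟨ length-filter-applyUpTo _ id x ⟩
    tally x _
      ≡⟨ tally-cong x (λ a<x → cong₂ (λ c d → c ∧ not d)
           (strictlyBetweenᵇ≡ {T = T} {B} endT endB a<x s≤y) (any-uses Ps ends a<x s≤y)) ⟩
    tally x (λ a → vacant s (nth (δ T) a) (nth (δ B) a) (column (δs Ps) a))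
      ≡⟨ tally-vacant (δ B) s (δ T) chain ⟩
    chain-gaps (δ B) (δ T) (δs Ps) s ∎
    where open ≡-Reasoning

  uVec≡ : ∀ {k T B} {Ps : Vec Path k} → EndsAt x y T → EndsAt x y B → VAll (EndsAt x y) Ps →
          Chain (δ B) (δ T) (δs Ps) →
          uVec x y T B Ps ≡ map (λ j → chain-gaps (δ B) (δ T) (δs Ps) (suc j)) (upTo (y ∸ 1))
  -- Entry `j` belongs to depth `suc j`, and `suc j ≤ y ∸ 1 ≤ y` gives the bound that
  -- `uₛ≡chain-gaps` asks for.
  uVec≡ {T = T} {B} endT endB ends chain = map-cong-local (All.applyUpTo⁺₁ id (y ∸ 1) (λ j<y-1 →
    uₛ≡chain-gaps {T = T} {B} endT endB ends chain (≤-trans j<y-1 (m∸n≤m y 1))))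

  weaklyAbove⇒≼ : ∀ {P Q} → EndsAt x y P → EndsAt x y Q → weaklyAboveᵇ P Q ≡ true → δ P ≼ δ Q
  weaklyAbove⇒≼ {P} {Q} endP endQ above
    with δ P ≼? δ Q | ≡-trans (≡-sym (weaklyAboveᵇ≡ {P = P} {Q} endP endQ)) above
  ... | yes P≼Q | _ = P≼Q

  ≼⇒weaklyAbove : ∀ {P Q} → EndsAt x y P → EndsAt x y Q → δ P ≼ δ Q → weaklyAboveᵇ P Q ≡ true
  ≼⇒weaklyAbove {P} {Q} endP endQ P≼Q =
    ≡-trans (weaklyAboveᵇ≡ {P = P} {Q} endP endQ) (dec-true (δ P ≼? δ Q) P≼Q)

  private
    ∧-true : ∀ {c d} → (c ∧ d) ≡ true → c ≡ true × d ≡ true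
    ∧-true {true} {true} _ = ≡-refl , ≡-refl

  chain⇒chainᵇ : ∀ {k T B} {Ps : Vec Path k} → EndsAt x y T → VAll (EndsAt x y) Ps →
                 Chain (δ B) (δ T) (δs Ps) → chainᵇ T Ps ≡ true
  chain⇒chainᵇ {Ps = []}             endT []            (end _)       = ≡-refl
  chain⇒chainᵇ {T = T} {B} {P ∷ Ps} endT (endP ∷ ends) (T≼P ∷ chain) =
    cong₂ _∧_ (≼⇒weaklyAbove {T} {P} endT endP T≼P) (chain⇒chainᵇ {T = P} {B} endP ends chain)

  chain⇒allWeaklyBetween : ∀ {k T B} {Ps : Vec Path k} → EndsAt x y T → EndsAt x y B → VAll (EndsAt x y) Ps →
                           Chain (δ B) (δ T) (δs Ps) → allWeaklyBetweenᵇ T B Ps ≡ true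
  chain⇒allWeaklyBetween {T = T} {B} {Ps} endT endB ends chain =
    go Ps ends (chain-top (δ B) chain) (chain-bottom (δ B) chain)
    where
    go : ∀ {k} (Ps : Vec Path k) → VAll (EndsAt x y) Ps → VAll (δ T ≼_) (δs Ps) → VAll (_≼ δ B) (δs Ps) →
         allWeaklyBetweenᵇ T B Ps ≡ true
    go []       []            []         []         = ≡-refl
    go (P ∷ Ps) (endP ∷ ends) (T≼P ∷ ts) (P≼B ∷ bs) = cong₂ _∧_
      (cong₂ _∧_ (≼⇒weaklyAbove {T} {P} endT endP T≼P) (≼⇒weaklyAbove {P} {B} endP endB P≼B))
      (go Ps ends ts bs)

  -- `chainᵇ` does not compare the last path with `B`; that comparison comes from
  -- `allWeaklyBetweenᵇ`, or from `δ T ≼ δ B` if the tuple is empty. `T′` keeps the original top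
  -- while `T` moves down the chain.
  chainᵇ⇒chain : ∀ {k T T′ B} {Ps : Vec Path k} → EndsAt x y T → EndsAt x y B → VAll (EndsAt x y) Ps →
                 δ T ≼ δ B → allWeaklyBetweenᵇ T′ B Ps ≡ true → chainᵇ T Ps ≡ true →
                 Chain (δ B) (δ T) (δs Ps)
  chainᵇ⇒chain {Ps = []} endT endB [] T≼B _ _ = end T≼B
  chainᵇ⇒chain {T = T} {T′} {B} {P ∷ Ps} endT endB (endP ∷ ends) T≼B between chain =
    weaklyAbove⇒≼ {T} {P} endT endP (proj₁ (∧-true chain)) ∷
    chainᵇ⇒chain {T = P} {T′} {B} endP endB ends
      (weaklyAbove⇒≼ {P} {B} endP endB (proj₂ (∧-true {weaklyAboveᵇ T′ P} (proj₁ (∧-true between)))))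
      (proj₂ (∧-true between)) (proj₂ (∧-true {weaklyAboveᵇ T P} chain))

  module _ {c ℓ : Level} (R : CommutativeSemiring c ℓ) (B : Path)
           (k : ℕ) (u : List ℕ) (z : Fin (suc k) → CommutativeSemiring.Carrier R) where
    open CommutativeSemiring R using (Carrier; _≈_; _*_; setoid; *-cong; reflexive; rawSemiring)
      renaming (refl to ≈-refl; sym to ≈-sym; trans to ≈-trans)
    open import Algebra.Definitions.RawSemiring rawSemiring using (_^_)
    open Sums R
    open Chains R y (δ B) (depths-decreasing x y B)
    open import Relation.Binary.Reasoning.Setoid setoid

    -- Tuples are built path by path, so the sum over them nests like `chainSum`; `map-depths-paths`
    -- turns each sum over paths into one over `seqs`.
    ∑-tuples : ∀ {k} T (Φ : Weight k) →
               ∑ R (tuples x y k) (λ Ps → guard (does (chain? (δ B) T (δs Ps)))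
                 (Φ (chain-contacts (δ B) T (δs Ps)) (chain-gaps (δ B) T (δs Ps)))) ≈ chainSum k T Φ
    ∑-tuples {zero}  T Φ = CommutativeSemiring.+-identityʳ R _
    ∑-tuples {suc k} T Φ = begin
      ∑ R (tuples x y (suc k)) _
        ≈⟨ ∑-concatMap (λ P → map (P ∷_) (tuples x y k)) (paths x y) ⟩
      ∑ R (paths x y) (λ P → ∑ R (map (P ∷_) (tuples x y k)) _)
        ≈⟨ ∑-cong (paths x y) (λ P → begin
             ∑ R (map (P ∷_) (tuples x y k)) _
               ≡⟨ ∑-map (P ∷_) (tuples x y k) ⟩
             ∑ R (tuples x y k) _
               ≈⟨ ∑-cong (tuples x y k) (λ Ps → reflexive (guard-∧ (T ≼ᵇ δ P) (does (chain? (δ B) (δ P) (δs Ps))))) ⟩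
             ∑ R (tuples x y k) _
               ≈⟨ ∑-guard (T ≼ᵇ δ P) (tuples x y k) ⟩
             guard (T ≼ᵇ δ P) (∑ R (tuples x y k) _)
               ≈⟨ guard-cong (T ≼ᵇ δ P) (λ _ → ∑-tuples (δ P) (cons T (δ P) Φ)) ⟩
             guard (T ≼ᵇ δ P) (chainSum k (δ P) (cons T (δ P) Φ)) ∎) ⟩
      ∑ R (paths x y) (λ P → guard (T ≼ᵇ δ P) (chainSum k (δ P) (cons T (δ P) Φ)))
        ≡⟨ ∑-map δ (paths x y) ⟨
      ∑ R (map δ (paths x y)) (λ P → guard (T ≼ᵇ P) (chainSum k P (cons T P Φ)))
        ≡⟨ cong (λ Ps → ∑ R Ps (λ P → guard (T ≼ᵇ P) (chainSum k P (cons T P Φ)))) (map-depths-paths x y) ⟩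
      chainSum (suc k) T Φ ∎

    -- The constraint on 𝐮 is a guard inside the weight; `permute` leaves it alone, since it acts on
    -- `h` only.
    weight : Weight k
    weight h g = guard (map (λ j → g (suc j)) (upTo (y ∸ 1)) ==ℕs u) (∏ R (suc k) (λ i → z i ^ h i))

    ∏-cong : ∀ n {f g : Fin n → Carrier} → (∀ i → f i ≈ g i) → ∏ R n f ≈ ∏ R n g
    ∏-cong zero    f≈g = ≈-refl
    ∏-cong (suc n) f≈g = *-cong (f≈g zero) (∏-cong n (f≈g ∘ suc))

    ∏-^-cong : ∀ {h h′ : Fin (suc k) → ℕ} → h ≗ h′ → ∏ R (suc k) (λ i → z i ^ h i) ≈ ∏ R (suc k) (λ i → z i ^ h′ i)
    ∏-^-cong h≗ = ∏-cong (suc k) (λ i → reflexive (cong (z i ^_) (h≗ i)))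

    weight-ext : Extensional weight
    weight-ext {h} {h′} {g} {g′} h≗ g≗ = ≈-trans
      (reflexive (cong (λ us → guard (us ==ℕs u) _) (map-cong (λ j → g≗ (suc j)) (upTo (y ∸ 1)))))
      (guard-cong (map (λ j → g′ (suc j)) (upTo (y ∸ 1)) ==ℕs u) (λ _ → ∏-^-cong h≗))

    genFun≈chainSum : ∀ {T} → EndsAt x y T → EndsAt x y B → WeaklyAbove T B → ∀ σ →
               genFun R x y k T B u z σ ≈ chainSum k (δ T) (permute σ weight)
    genFun≈chainSum {T} endT endB T-above-B σ = begin
      genFun R x y k T B u z σ
        ≈⟨ ∑-filter _ (tuples x y k) ⟩
      ∑ R (tuples x y k) _
        ≈⟨ ∑-cong-All (All.map (λ {Ps} → translate Ps) (tuples-endAt x y k)) ⟩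
      ∑ R (tuples x y k) _
        ≈⟨ ∑-tuples (δ T) (permute σ weight) ⟩
      chainSum k (δ T) (permute σ weight) ∎
      where
      translate : ∀ Ps → VAll (EndsAt x y) Ps →
        guard (allWeaklyBetweenᵇ T B Ps ∧ chainᵇ T Ps ∧ (uVec x y T B Ps ==ℕs u))
              (∏ R (suc k) (λ i → z i ^ h T B Ps (σ i))) ≈
        guard (does (chain? (δ B) (δ T) (δs Ps)))
              (permute σ weight (chain-contacts (δ B) (δ T) (δs Ps)) (chain-gaps (δ B) (δ T) (δs Ps)))
      translate Ps ends with chain? (δ B) (δ T) (δs Ps)
      ... | yes chain
        rewrite chain⇒allWeaklyBetween {T = T} {B} endT endB ends chain
              | chain⇒chainᵇ {T = T} {B} endT ends chain
              | uVec≡ {T = T} {B} {Ps} endT endB ends chain =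
          guard-cong (map (λ j → chain-gaps (δ B) (δ T) (δs Ps) (suc j)) (upTo (y ∸ 1)) ==ℕs u)
                  (λ _ → ∏-^-cong (λ i → h≡chain-contacts {T = T} {B} endT endB ends (σ i)))
      -- If both Boolean tests succeeded, `T` weakly above `B` would make the tuple a chain.
      ... | no ¬chain
        with allWeaklyBetweenᵇ T B Ps in between | chainᵇ T Ps in chain
      ... | false | _     = ≈-refl
      ... | true  | false = ≈-refl
      ... | true  | true  = contradiction
        (chainᵇ⇒chain {T = T} {T} {B} endT endB ends (weaklyAbove⇒≼ {T} {B} endT endB T-above-B) between chain) ¬chain

theorem5p1 : ∀ {c ℓ : Level} (x y : ℕ) (T B : Path) →
    EndsAt x y T → EndsAt x y B → WeaklyAbove T B →
    (k : ℕ) → k ≥ 1 → (u : List ℕ) → (π : Permutation′ (ℕ.suc k)) →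
    (R : CommutativeSemiring c ℓ) → (z : Fin (ℕ.suc k) → CommutativeSemiring.Carrier R) →
    CommutativeSemiring._≈_ R
    (genFun R x y k T B u z (λ i → i))
    (genFun R x y k T B u z (λ i → π ⟨$⟩ʳ i))
theorem5p1 x y T B endT endB T-above-B k _ u π R z = begin
  genFun R x y k T B u z id         ≈⟨ genFun≈chainSum {x} {y} R B k u z {T} endT endB T-above-B id ⟩
  chainSum k (depths x y T) Φ
    ≈⟨ Symmetric-permutation π (depths x y T) Φ (depths-decreasing x y T) (weight-ext {x} {y} R B k u z) ⟩
  chainSum k (depths x y T) (permute (π ⟨$⟩ʳ_) Φ)
    ≈⟨ genFun≈chainSum {x} {y} R B k u z {T} endT endB T-above-B (π ⟨$⟩ʳ_) ⟨
  genFun R x y k T B u z (π ⟨$⟩ʳ_)  ∎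
  where
  open Chains R y (depths x y B) (depths-decreasing x y B)
  open import Relation.Binary.Reasoning.Setoid (CommutativeSemiring.setoid R)
  Φ : Weight k
  Φ = weight {x} {y} R B k u z
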